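{- For every $\eta>0$ there exists an integer $n_0=n_0(\eta)$ such that the following holds. Let $G$ be a digraph on $n\ge n_0$ vertices with outdegree sequence $d^+_1\le\dots\le d^+_n$ and indegree sequence $d^-_1\le\dots\le d^-_n$, and suppose that for all $i<n/2$: (i) $d^+_i\ge i+\eta n$ or $d^-_{n-i-\eta n}\ge n-i$, and (ii) $d^-_i\ge i+\eta n$ or $d^+_{n-i-\eta n}\ge n-i$. Then $G$ contains a Hamilton cycle.
   Context: Digraphs have no loops and at most one edge in each direction between any pair of vertices. The out- and indegree sequences are each sorted in non-decreasing order separately, so $d^+_i$ and $d^-_i$ need not be degrees of the same vertex. -}

module Defs where

open import Data.Bool using (Bool; true; false)
open import Data.Nat using (ℕ; zero; suc; _<_; _≤_; _≤?_)
open import Data.Nat.Properties using (≤-decTotalOrder)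
open import Data.Fin using (Fin; toℕ; fromℕ<; zero; suc)
open import Data.Fin.Permutation using (Permutation′; _⟨$⟩ʳ_)
open import Data.List using (List; []; _∷_; map; filter; length; allFin)
open import Data.Integer using (+_)
open import Data.Rational using (ℚ; _/_)
open import Relation.Binary.PropositionalEquality using (_≡_)
open import Relation.Nullary.Decidable using (yes; no)
import Data.List.Sort.InsertionSort as IS

record Digraph (n : ℕ) : Set where
  field
    E        : Fin n → Fin n → Bool
    loopless : ∀ v → E v v ≡ false
open Digraph public

count : ∀ {n} → (Fin n → Bool) → ℕ
count {n} f = length (filter (λ x → f x Data.Bool.≟ true) (allFin n))

outdeg : ∀ {n} → Digraph n → Fin n → ℕ
outdeg G v = count (λ w → E G v w)

indeg : ∀ {n} → Digraph n → Fin n → ℕ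
indeg G v = count (λ u → E G u v)

sortℕ : List ℕ → List ℕ
sortℕ = IS.sort ≤-decTotalOrder

-- 1-based lookup (default 0 outside 1..length; only used in range)
nth : List ℕ → ℕ → ℕ
nth []       _             = 0
nth (x ∷ xs) zero          = 0
nth (x ∷ xs) (suc zero)    = x
nth (x ∷ xs) (suc (suc k)) = nth xs (suc k)

d⁺ : ∀ {n} → Digraph n → ℕ → ℕ
d⁺ {n} G = nth (sortℕ (map (outdeg G) (allFin n)))

d⁻ : ∀ {n} → Digraph n → ℕ → ℕ
d⁻ {n} G = nth (sortℕ (map (indeg G) (allFin n)))

ℚ[_] : ℕ → ℚ
ℚ[ m ] = (+ m) / 1

next : ∀ {n} → Fin n → Fin n
next {suc n} k with suc (toℕ k) Data.Nat.<? suc n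
... | yes p = fromℕ< p
... | no _  = zero

HamiltonCycle : ∀ {n} → Digraph n → Set
HamiltonCycle {n} G =
  Σ (Permutation′ n) λ π → ∀ k → E G (π ⟨$⟩ʳ k) (π ⟨$⟩ʳ next k) ≡ true
  where open import Data.Product using (Σ)

{-# OPTIONS --safe #-}
-- Every cyclic order of the vertices is improved until consecutive vertices are joined. Write H u w if u
-- may be followed by the present successor of w. If v is not joined to its successor, H contains classes
-- T 0 ⇒ T 1 ⇒ … ⇒ T l ⇒ T 0, completely joined in this cyclic order, each consisting of three vertices
-- x < y < z lying close together on the cyclic order, with T 0 in the out-neighbourhood and some T m in the
-- in-neighbourhood of v. They exist because the degree conditions make H a robust expander, whatever the
-- order is, and because constantly many dense sets always contain a few with dense intersection.
-- Rotate the rows of x and of y, and v followed by the first z; this repairs v but may split the cycle.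
-- Exchanging the images of two vertices with images in the same class merges their cycles if these differ,
-- so we may assume that they agree. The vertex sent to an x is then on one cycle with the y of the previous
-- class and, as x runs into its own y, with the y of this class. Hence there is only one cycle,
-- which has fewer missing edges.
module Submission where

-- `H` changes with the order, so its expansion is needed for every order. It arises from `E` by
-- renaming tails and heads with two separate permutations. Numbers of vertices of large degree
-- survive this, looplessness does not; hence the degree sequences become such numbers first, and
-- the minimum degrees, whose proof uses looplessness, are kept in `DegreeCond`. Densities must not
-- decay along the classes. The next class is chosen in a common neighbourhood of the present one,
-- and its density is a function of the density of single neighbourhoods alone, however sparse the
-- set was from which the present class came. The vertices of a class share a block, an interval of
-- constant length `L` that meets neither another class nor `v`. So all moved vertices are distinct
-- and none lies between x and y; the walk entering behind x therefore reaches y. Constants: a is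
-- the denominator of η, e = n / (8a) is the unit of slack, and names with K are reciprocals of
-- densities: `K` of neighbourhoods, `KB` of the common in-neighbourhood of `T 0`, `Kw` of the
-- robust threshold, `KA` of the sets from which classes are chosen.

module Counting where

  open import Data.Bool using (Bool; true; false; _∧_; not)
  open import Data.Empty using (⊥-elim)
  open import Data.Fin using (Fin; zero; suc)
  open import Data.Fin.Permutation using (Permutation′; _⟨$⟩ʳ_)
  open import Data.Nat
  open import Data.Nat.Properties
  open import Data.Product using (∃; _×_; _,_)
  open import Function using (_∘_)
  open import Relation.Binary.PropositionalEquality
  open import Algebra.Properties.CommutativeMonoid.Sum +-0-commutativeMonoid using (sum; sum-cong-≗; ∑-distrib-+; ∑-comm; sum-permute) public
  open import Algebra.Properties.Semiring.Sum +-*-semiring using (*-distribˡ-sum) public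

  -- Certificate for linear arithmetic: the hypotheses are added up to one inequality `L ≤ R`, `s`
  -- is the slack, and what remains is an identity for the ring solver.
  ≤-by : ∀ {L R A B} s → L ≤ R → A + R + s ≡ B + L → A ≤ B
  ≤-by {L} {R} {A} {B} s L≤R eq = +-cancelʳ-≤ R A B (begin
    A + R      ≤⟨ m≤m+n (A + R) s ⟩
    A + R + s  ≡⟨ eq ⟩
    B + L      ≤⟨ +-monoʳ-≤ B L≤R ⟩
    B + R      ∎)
    where open ≤-Reasoning

  -- Decidable sets of vertices and their cardinalities.

  Sub : ℕ → Set
  Sub n = Fin n → Bool

  Rel : ℕ → Set
  Rel n = Fin n → Fin n → Bool

  _ᵀ : ∀ {n} → Rel n → Rel n
  (R ᵀ) x y = R y x

  _∩_ : ∀ {n} → Sub n → Sub n → Sub n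
  (A ∩ B) x = A x ∧ B x

  ∁ : ∀ {n} → Sub n → Sub n
  ∁ A x = not (A x)

  infixr 7 _∩_
  infix 9 _ᵀ

  ⟦_⟧ : Bool → ℕ
  ⟦ true ⟧  = 1
  ⟦ false ⟧ = 0

  ♯ : ∀ {n} → Sub n → ℕ
  ♯ A = sum (λ x → ⟦ A x ⟧)

  sum-mono : ∀ {n} (f g : Fin n → ℕ) → (∀ x → f x ≤ g x) → sum f ≤ sum g
  sum-mono {zero}  f g h = z≤n
  sum-mono {suc n} f g h = +-mono-≤ (h zero) (sum-mono (f ∘ suc) (g ∘ suc) (h ∘ suc))

  sum-const : ∀ n c → sum {n} (λ _ → c) ≡ n * c
  sum-const zero    c = refl
  sum-const (suc n) c = cong (c +_) (sum-const n c)

  ∧-true : ∀ {a b} → a ∧ b ≡ true → a ≡ true × b ≡ true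
  ∧-true {true} {true} _ = refl , refl

  ∧-intro : ∀ {a b} → a ≡ true → b ≡ true → a ∧ b ≡ true
  ∧-intro refl refl = refl

  not-true : ∀ {a} → not a ≡ true → a ≡ false
  not-true {false} _ = refl

  ⟦⟧-mono : ∀ {a b} → (a ≡ true → b ≡ true) → ⟦ a ⟧ ≤ ⟦ b ⟧
  ⟦⟧-mono {false}         h = z≤n
  ⟦⟧-mono {true}  {true}  h = ≤-refl
  ⟦⟧-mono {true}  {false} h with () ← h refl

  ♯-mono : ∀ {n} (A B : Sub n) → (∀ x → A x ≡ true → B x ≡ true) → ♯ A ≤ ♯ B
  ♯-mono A B h = sum-mono _ _ (λ x → ⟦⟧-mono (h x))

  ♯-cong : ∀ {n} {A B : Sub n} → A ≗ B → ♯ A ≡ ♯ B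
  ♯-cong h = sum-cong-≗ (λ x → cong ⟦_⟧ (h x))

  ♯-permute : ∀ {n} (A : Sub n) (π : Permutation′ n) → ♯ (λ x → A (π ⟨$⟩ʳ x)) ≡ ♯ A
  ♯-permute A π = sym (sum-permute (λ x → ⟦ A x ⟧) π)

  ♯-split : ∀ {n} (A B : Sub n) → ♯ (A ∩ B) + ♯ (A ∩ ∁ B) ≡ ♯ A
  ♯-split A B = trans (sym (∑-distrib-+ (λ x → ⟦ A x ∧ B x ⟧) (λ x → ⟦ A x ∧ not (B x) ⟧))) (sum-cong-≗ (λ x → pt (A x) (B x)))
    where
    pt : ∀ a b → ⟦ a ∧ b ⟧ + ⟦ a ∧ not b ⟧ ≡ ⟦ a ⟧
    pt true  true  = refl
    pt true  false = refl
    pt false b     = refl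

  ♯-full : ∀ n → ♯ {n} (λ _ → true) ≡ n
  ♯-full n = trans (sum-const n 1) (*-identityʳ n)

  ♯-∁ : ∀ {n} (A : Sub n) → ♯ A + ♯ (∁ A) ≡ n
  ♯-∁ {n} A = trans (♯-split (λ _ → true) A) (♯-full n)

  ♯≤n : ∀ {n} (A : Sub n) → ♯ A ≤ n
  ♯≤n A = subst (♯ A ≤_) (♯-∁ A) (m≤m+n _ _)

  ♯-∩ : ∀ {n} (A B : Sub n) → ♯ A + ♯ B ≤ ♯ (A ∩ B) + n
  ♯-∩ {n} A B = begin
    ♯ A + ♯ B                              ≡⟨ ∑-distrib-+ (λ x → ⟦ A x ⟧) (λ x → ⟦ B x ⟧) ⟨
    sum (λ x → ⟦ A x ⟧ + ⟦ B x ⟧)          ≤⟨ sum-mono _ _ (λ x → pt (A x) (B x)) ⟩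
    sum (λ x → ⟦ A x ∧ B x ⟧ + 1)          ≡⟨ ∑-distrib-+ (λ x → ⟦ A x ∧ B x ⟧) (λ _ → 1) ⟩
    ♯ (A ∩ B) + ♯ {n} (λ _ → true)         ≡⟨ cong (♯ (A ∩ B) +_) (♯-full n) ⟩
    ♯ (A ∩ B) + n                          ∎
    where
    open ≤-Reasoning
    pt : ∀ a b → ⟦ a ⟧ + ⟦ b ⟧ ≤ ⟦ a ∧ b ⟧ + 1
    pt true  true  = ≤-refl
    pt true  false = ≤-refl
    pt false true  = ≤-refl
    pt false false = z≤n

  ♯-pos : ∀ {n} (A : Sub n) → 1 ≤ ♯ A → ∃ λ x → A x ≡ true
  ♯-pos {suc n} A h with A zero in eq
  ... | true  = zero , eq
  ... | false with ♯-pos (A ∘ suc) h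
  ...   | x , Ax = suc x , Ax

  ♯-member : ∀ {n} (A : Sub n) x → A x ≡ true → 1 ≤ ♯ A
  ♯-member A zero    h rewrite h = s≤s z≤n
  ♯-member A (suc x) h = ≤-trans (♯-member (A ∘ suc) x h) (m≤n+m _ ⟦ A zero ⟧)

  ♯-strict : ∀ {n} {A B : Sub n} → (∀ x → A x ≡ true → B x ≡ true) →
             ∀ y → A y ≡ false → B y ≡ true → suc (♯ A) ≤ ♯ B
  ♯-strict {A = A} {B} h y Ay By = begin
    1 + ♯ A                       ≤⟨ +-mono-≤ (♯-member (B ∩ ∁ A) y (∧-intro By (cong not Ay)))
                                              (♯-mono A (B ∩ A) (λ x Ax → ∧-intro (h x Ax) Ax)) ⟩
    ♯ (B ∩ ∁ A) + ♯ (B ∩ A)       ≡⟨ +-comm (♯ (B ∩ ∁ A)) _ ⟩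
    ♯ (B ∩ A) + ♯ (B ∩ ∁ A)       ≡⟨ ♯-split B A ⟩
    ♯ B                           ∎
    where open ≤-Reasoning

  ♯-n⇒all : ∀ {n} (A : Sub n) → n ≤ ♯ A → ∀ x → A x ≡ true
  ♯-n⇒all {n} A h x with A x in eq
  ... | true  = refl
  ... | false = ⊥-elim (<⇒≱ (subst (suc (♯ A) ≤_) (♯-full n) (♯-strict {A = A} (λ _ _ → refl) x eq refl)) h)

  ♯-*-sum : ∀ {n} (A : Sub n) (g : Fin n → ℕ) c → (∀ x → A x ≡ true → c ≤ g x) →
            ♯ A * c ≤ sum g
  ♯-*-sum A g c h = begin
    ♯ A * c                        ≡⟨ *-comm (♯ A) c ⟩
    c * ♯ A                        ≡⟨ *-distribˡ-sum c (λ x → ⟦ A x ⟧) ⟩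
    sum (λ x → c * ⟦ A x ⟧)        ≤⟨ sum-mono _ _ (λ x → pt x (A x) refl) ⟩
    sum g                          ∎
    where
    open ≤-Reasoning
    pt : ∀ x b → A x ≡ b → c * ⟦ b ⟧ ≤ g x
    pt x true  eq = subst (_≤ g x) (sym (*-identityʳ c)) (h x eq)
    pt x false eq = subst (_≤ g x) (sym (*-zeroʳ c)) z≤n

-- Edges between large sets, from the degree conditions.

module Expansion where

  open import Data.Bool using (true; false; _∧_)
  open import Data.Empty using (⊥-elim)
  open import Data.Fin using (zero; suc)
  open import Data.List using ([]; _∷_)
  open import Data.Nat
  open import Data.Nat.DivMod using (m≡m%n+[m/n]*n; m%n<n)
  open import Data.Nat.Properties
  open import Data.Nat.Tactic.RingSolver using (solve; solve-∀)
  open import Data.Product using (proj₁; proj₂)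
  open import Data.Sum using (_⊎_; inj₁; inj₂)
  open import Relation.Binary.PropositionalEquality
  open import Relation.Nullary.Decidable using (⌊_⌋; yes; no; Dec)
  open Counting

  ⌊⌋-true : ∀ {P : Set} (d : Dec P) → ⌊ d ⌋ ≡ true → P
  ⌊⌋-true (yes p) _ = p

  true-⌊⌋ : ∀ {P : Set} (d : Dec P) → P → ⌊ d ⌋ ≡ true
  true-⌊⌋ (yes _) _ = refl
  true-⌊⌋ (no ¬p) p = ⊥-elim (¬p p)

  -- One half of the degree condition as a statement on numbers of vertices, with 8e in place of ηn:
  -- the i-th smallest out-degree is at least w exactly if more than n - i vertices have out-degree
  -- at least w. In this form it is invariant under renaming of tails and heads.
  Half : ∀ {n} → ℕ → Rel n → Set
  Half {n} e R = ∀ i → 1 ≤ i → 2 * i < n →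
      n < ♯ (λ x → ⌊ i + 8 * e ≤? ♯ (R x) ⌋) + i
    ⊎ i + 8 * e ≤ ♯ (λ y → ⌊ n ≤? ♯ ((R ᵀ) y) + i ⌋)

  record DegreeCond {n} (e : ℕ) (R : Rel n) : Set where
    field
      half-out : Half e R
      half-in  : Half e (R ᵀ)
      min-out  : ∀ x → 8 * e ≤ ♯ (R x)
      min-in   : ∀ y → 8 * e ≤ ♯ ((R ᵀ) y)

  edges : ∀ {n} → Rel n → Sub n → Sub n → ℕ
  edges R T S = sum (λ x → ♯ (λ y → T x ∧ (R x y ∧ S y)))

  edges-ᵀ : ∀ {n} (R : Rel n) T S → edges (R ᵀ) S T ≡ edges R T S
  edges-ᵀ R T S = trans
    (∑-comm (λ y x → ⟦ S y ∧ (R x y ∧ T x) ⟧))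
    (sum-cong-≗ (λ x → sum-cong-≗ (λ y → cong ⟦_⟧ (pt (S y) (R x y) (T x)))))
    where
    pt : ∀ s r t → s ∧ (r ∧ t) ≡ t ∧ (r ∧ s)
    pt true  true  true  = refl
    pt true  true  false = refl
    pt true  false true  = refl
    pt true  false false = refl
    pt false true  true  = refl
    pt false true  false = refl
    pt false false true  = refl
    pt false false false = refl

  edges-rows : ∀ {n} (R : Rel n) (T S X : Sub n) c → (∀ x → X x ≡ true → T x ≡ true) →
               (∀ x → X x ≡ true → c ≤ ♯ (R x ∩ S)) → ♯ X * c ≤ edges R T S
  edges-rows R T S X c X⊆T h = ♯-*-sum X _ c (λ x Xx →
    ≤-trans (h x Xx) (♯-mono (R x ∩ S) _ (λ y RSy → ∧-intro (X⊆T x Xx) RSy)))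

  edges-upper : ∀ {n} (R : Rel n) (T S : Sub n) K m →
                (∀ x → T x ≡ true → K * ♯ (R x ∩ S) ≤ m) → K * edges R T S ≤ n * m
  edges-upper {n} R T S K m h = begin
    K * edges R T S                                        ≡⟨ *-distribˡ-sum K (λ x → ♯ (λ y → T x ∧ (R x y ∧ S y))) ⟩
    sum (λ x → K * ♯ (λ y → T x ∧ (R x y ∧ S y)))          ≤⟨ sum-mono _ _ pt ⟩
    sum {n} (λ _ → m)                                      ≡⟨ sum-const n m ⟩
    n * m                                                  ∎
    where
    open ≤-Reasoning
    pt : ∀ x → K * ♯ (λ y → T x ∧ (R x y ∧ S y)) ≤ m
    pt x with T x in eq
    ... | true  = h x eq
    ... | false = subst (_≤ m) (sym (trans (cong (K *_) (trans (sum-const n 0) (*-zeroʳ n))) (*-zeroʳ K))) z≤n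

  private
    high-in-T : ∀ n a i e T X → suc n ≤ a + i → i + e ≤ T → T + a ≤ X + n → e ≤ X
    high-in-T n a i e T X p q r = ≤-by 1 (+-mono-≤ p (+-mono-≤ q r)) (solve (n ∷ a ∷ i ∷ e ∷ T ∷ X ∷ []))

    neighbours-in-S : ∀ n i e o S N → i + 8 * e ≤ o → n ≤ S + i + 7 * e → o + S ≤ N + n → e ≤ N
    neighbours-in-S n i e o S N p q r = ≤-by 0 (+-mono-≤ p (+-mono-≤ q r)) (solve (n ∷ i ∷ e ∷ o ∷ S ∷ N ∷ []))

    neighbours-in-T : ∀ n i e d T N → n ≤ d + i → i + e ≤ T → d + T ≤ N + n → e ≤ N
    neighbours-in-T n i e d T N p q r = ≤-by 0 (+-mono-≤ p (+-mono-≤ q r)) (solve (n ∷ i ∷ e ∷ d ∷ T ∷ N ∷ []))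

  -- Inclusion-exclusion twice. In the first alternative more than n - i vertices have out-degree at
  -- least i + 8e; at least e of them lie in `T`, and each has e neighbours in `S`, which misses at
  -- most i + 7e vertices. In the second, e vertices of `S` have in-degree at least n - i, hence e
  -- in-neighbours in `T`.
  edges-half : ∀ {n} e (R : Rel n) T S i → Half e R → 1 ≤ i → 2 * i < n →
               i + e ≤ ♯ T → n ≤ ♯ S + i + 7 * e → e * e ≤ edges R T S
  edges-half {n} e R T S i half 1≤i 2i<n i+e≤T n≤S+i with half i 1≤i 2i<n
  ... | inj₁ p = ≤-trans
    (*-monoˡ-≤ e (high-in-T n (♯ Hi) i e (♯ T) (♯ (T ∩ Hi)) p i+e≤T (♯-∩ T Hi)))
    (edges-rows R T S (T ∩ Hi) e (λ x h → proj₁ (∧-true h))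
      (λ x h → neighbours-in-S n i e (♯ (R x)) (♯ S) _ (⌊⌋-true (_ ≤? _) (proj₂ (∧-true {T x} h))) n≤S+i (♯-∩ (R x) S)))
    where
    Hi : Sub n
    Hi x = ⌊ i + 8 * e ≤? ♯ (R x) ⌋
  ... | inj₂ p = subst (e * e ≤_) (edges-ᵀ R T S) (≤-trans
    (*-monoˡ-≤ e (neighbours-in-S n i e (♯ Hi) (♯ S) (♯ (Hi ∩ S)) p n≤S+i (♯-∩ Hi S)))
    (edges-rows (R ᵀ) S T (Hi ∩ S) e (λ x h → proj₂ (∧-true {Hi x} h))
      (λ y h → neighbours-in-T n i e (♯ ((R ᵀ) y)) (♯ T) _ (⌊⌋-true (_ ≤? _) (proj₁ (∧-true h))) i+e≤T (♯-∩ ((R ᵀ) y) T))))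
    where
    Hi : Sub n
    Hi y = ⌊ n ≤? ♯ ((R ᵀ) y) + i ⌋

  private
    index-suffices : ∀ n e t T S → t + e ≡ T → n ≤ S + T + e → n ≤ S + t + 7 * e
    index-suffices n e t T S refl p = ≤-by (5 * e) p (solve (n ∷ e ∷ t ∷ S ∷ []))

    index-positive : ∀ e t T → t + e ≡ T → 2 * e ≤ T → 1 ≤ e → 1 ≤ t
    index-positive e t _ refl p q = ≤-by 0 (+-mono-≤ p q) (solve (e ∷ t ∷ []))

    index-bound : ∀ i t n → n ≤ 2 * t → 2 * i < n → i ≤ t
    index-bound i t n p q = <⇒≤ (*-cancelˡ-< 2 i t (<-≤-trans q p))

    -- For two sets both of size at least half the vertices plus e: `suc n` is the number of
    -- vertices and `i` the largest index strictly below half of it.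
    middle-index-suffices : ∀ n i s e S → s + e ≡ S → suc n ≤ 2 * s → n ≤ suc (2 * i) → 1 ≤ e → suc n ≤ S + i + 7 * e
    middle-index-suffices n i s e _ refl p q r = *-cancelˡ-≤ 2
      (≤-by (13 + e) (+-mono-≤ p (+-mono-≤ q (*-monoʳ-≤ 15 r))) (eq n i s e))
      where
      eq : ∀ n i s e → 2 * (1 + n) + (2 * s + (1 + 2 * i + 15 * e)) + (13 + e)
                       ≡ 2 * (s + e + i + 7 * e) + (1 + n + (n + 15))
      eq = solve-∀

  -- Whichever of T, S is below n/2 (if any) dictates the index i at which the degree condition is used.
  edges-large : ∀ {n} e (R : Rel n) T S → DegreeCond e R → 1 ≤ e → 8 * e ≤ n →
                2 * e ≤ ♯ T → 2 * e ≤ ♯ S → n ≤ ♯ S + ♯ T + e → e * e ≤ edges R T S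
  edges-large {n} e R T S D 1≤e 8e≤n 2e≤T 2e≤S large with 2 * (♯ T ∸ e) <? n | 2 * (♯ S ∸ e) <? n
  ... | yes p | _ = edges-half e R T S (♯ T ∸ e) (DegreeCond.half-out D) (index-positive e _ _ t+e 2e≤T 1≤e) p
                      (≤-reflexive t+e) (index-suffices n e _ _ (♯ S) t+e large)
    where
    t+e : ♯ T ∸ e + e ≡ ♯ T
    t+e = m∸n+n≡m (≤-trans (m≤m+n e _) 2e≤T)
  ... | no p | yes q = subst (e * e ≤_) (edges-ᵀ R T S)
    (edges-half e (R ᵀ) S T (♯ S ∸ e) (DegreeCond.half-in D) (index-positive e _ _ s+e 2e≤S 1≤e) q
      (≤-reflexive s+e) (index-suffices n e _ _ (♯ T) s+e (subst (λ w → n ≤ w + e) (+-comm (♯ S) (♯ T)) large)))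
    where
    s+e : ♯ S ∸ e + e ≡ ♯ S
    s+e = m∸n+n≡m (≤-trans (m≤m+n e _) 2e≤S)
  edges-large {suc n} e R T S D 1≤e 8e≤n 2e≤T 2e≤S large | no p | no q =
    edges-half e R T S i (DegreeCond.half-out D) 1≤i 2i<n
      (subst (i + e ≤_) t+e (+-monoˡ-≤ e (index-bound i (♯ T ∸ e) (suc n) (≮⇒≥ p) 2i<n)))
      (middle-index-suffices n i (♯ S ∸ e) e (♯ S) s+e (≮⇒≥ q) n≤2i+1 1≤e)
    where
    t+e : ♯ T ∸ e + e ≡ ♯ T
    t+e = m∸n+n≡m (≤-trans (m≤m+n e _) 2e≤T)
    s+e : ♯ S ∸ e + e ≡ ♯ S
    s+e = m∸n+n≡m (≤-trans (m≤m+n e _) 2e≤S)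
    i : ℕ
    i = n / 2
    n≡ : n ≡ n % 2 + 2 * i
    n≡ = trans (m≡m%n+[m/n]*n n 2) (cong (n % 2 +_) (*-comm i 2))
    2i<n : 2 * i < suc n
    2i<n = s≤s (subst (2 * i ≤_) (sym n≡) (m≤n+m _ (n % 2)))
    n≤2i+1 : n ≤ suc (2 * i)
    n≤2i+1 = subst (_≤ suc (2 * i)) (sym n≡) (+-monoˡ-≤ (2 * i) (s≤s⁻¹ (m%n<n n 2)))
    pos : ∀ j → 8 ≤ suc (suc (2 * j)) → 1 ≤ j
    pos zero    (s≤s (s≤s ()))
    pos (suc j) _ = s≤s z≤n
    1≤i : 1 ≤ i
    1≤i = pos i (≤-trans (*-monoʳ-≤ 8 1≤e) (≤-trans 8e≤n (s≤s n≤2i+1)))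
  edges-large {zero} e R T S D 1≤e 8e≤n _ _ _ | no p | no q with () ← ≤-trans (*-monoʳ-≤ 8 1≤e) 8e≤n

-- Robust neighbourhoods and their iteration.

module Levels where

  open import Data.Bool using (true; false)
  open import Data.Empty using (⊥-elim)
  open import Data.Fin using (zero; suc)
  open import Data.List using ([]; _∷_)
  open import Data.Nat
  open import Data.Nat.Properties
  open import Data.Nat.Tactic.RingSolver using (solve; solve-∀)
  open import Data.Product using (_×_; _,_; proj₂)
  open import Data.Sum using (_⊎_; inj₁; inj₂)
  open import Relation.Binary.PropositionalEquality
  open import Relation.Nullary.Decidable using (⌊_⌋; yes; no)
  open Counting
  open Expansion

  Dense : ∀ {n} → ℕ → Sub n → Set
  Dense {n} K A = n ≤ K * ♯ A

  Dense-mono : ∀ {n K L} (A B : Sub n) → K ≤ L → (∀ x → A x ≡ true → B x ≡ true) → Dense K A → Dense L B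
  Dense-mono A B K≤L A⊆B d = ≤-trans d (*-mono-≤ K≤L (♯-mono A B A⊆B))

  -- The robust (in-)neighbourhood of Kühn, Osthus and Treglown, with threshold n / K.
  RN : ∀ {n} → ℕ → Rel n → Sub n → Sub n
  RN {n} K R S x = ⌊ n ≤? K * ♯ (R x ∩ S) ⌋

  RN-dense : ∀ {n} K (R : Rel n) S x → RN K R S x ≡ true → Dense K (R x ∩ S)
  RN-dense K R S x = ⌊⌋-true (_ ≤? _)

  RN-sparse : ∀ {n} K (R : Rel n) S x → RN K R S x ≡ false → K * ♯ (R x ∩ S) ≤ n
  RN-sparse {n} K R S x eq with n ≤? K * ♯ (R x ∩ S)
  ... | no ¬p = <⇒≤ (≰⇒> ¬p)

  RN-full : ∀ {n} K (R : Rel n) {S} → (∀ y → S y ≡ true) → (∀ x → Dense K (R x)) → ∀ x → RN K R S x ≡ true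
  RN-full K R {S} full d x =
    true-⌊⌋ (_ ≤? _) (Dense-mono (R x) (R x ∩ S) (≤-refl {K}) (λ y Rxy → ∧-intro Rxy (full y)) (d x))

  -- A vertex of the robust neighbourhood sends at most |S| edges into `S`, any other one at most n
  -- / K.
  RN-edges : ∀ {n} K (R : Rel n) S →
             K * edges R (λ _ → true) S ≤ ♯ (RN K R S) * (K * ♯ S) + n * n
  RN-edges {n} K R S = begin
    K * edges R (λ _ → true) S                       ≡⟨ *-distribˡ-sum K (λ x → ♯ (R x ∩ S)) ⟩
    sum (λ x → K * ♯ (R x ∩ S))                      ≤⟨ sum-mono _ _ pt ⟩
    sum (λ x → c * ⟦ RN K R S x ⟧ + n)               ≡⟨ ∑-distrib-+ (λ x → c * ⟦ RN K R S x ⟧) (λ _ → n) ⟩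
    sum (λ x → c * ⟦ RN K R S x ⟧) + sum {n} (λ _ → n)
      ≡⟨ cong₂ _+_ (sym (*-distribˡ-sum c (λ x → ⟦ RN K R S x ⟧))) (sum-const n n) ⟩
    c * ♯ (RN K R S) + n * n                         ≡⟨ cong (_+ n * n) (*-comm c _) ⟩
    ♯ (RN K R S) * c + n * n                         ∎
    where
    open ≤-Reasoning
    c : ℕ
    c = K * ♯ S
    pt : ∀ x → K * ♯ (R x ∩ S) ≤ c * ⟦ RN K R S x ⟧ + n
    pt x with RN K R S x in eq
    ... | true  = ≤-trans (*-monoʳ-≤ K (♯-mono (R x ∩ S) S (λ y h → proj₂ (∧-true {R x y} h))))
                          (≤-trans (≤-reflexive (sym (*-identityʳ c))) (m≤m+n _ n))
    ... | false = ≤-trans (RN-sparse K R S x eq) (m≤n+m n _)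

  private
    -- With s = |S| and r the size of the robust neighbourhood: the minimum in-degree forces 8es
    -- edges into `S`, of which at most n² / Kw ≤ es start outside the robust neighbourhood. So r ≥
    -- 7e, while s < 2e.
    small-expands : ∀ n e s r K KB Kw → 1 ≤ s → 1 ≤ Kw → K * KB ≤ Kw → n ≤ K * e → n ≤ KB * s →
           Kw * (s * (8 * e)) ≤ r * (Kw * s) + n * n → s < 2 * e → s + e ≤ r
    small-expands n e (suc s) r K KB (suc w) _ _ K≤ n≤ n≤′ h s<2e =
      ≤-by (4 * e) (+-mono-≤ 8e≤ (<⇒≤ s<2e)) (eq₃ e (suc s) r)
      where
      S = suc s
      W = suc w
      open ≤-Reasoning
      eq₁ : ∀ K e KB s → (K * e) * (KB * s) ≡ (K * KB) * (e * s)
      eq₁ = solve-∀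
      eq₂ : ∀ r w s e → r * (w * s) + w * (e * s) ≡ w * (s * (r + e))
      eq₂ = solve-∀
      eq₃ : ∀ e s r → s + e + (r + e + 2 * e) + 4 * e ≡ r + (8 * e + s)
      eq₃ = solve-∀
      8e≤ : 8 * e ≤ r + e
      8e≤ = *-cancelˡ-≤ S (*-cancelˡ-≤ W (begin
        W * (S * (8 * e))                     ≤⟨ h ⟩
        r * (W * S) + n * n                   ≤⟨ +-monoʳ-≤ _ (*-mono-≤ n≤ n≤′) ⟩
        r * (W * S) + (K * e) * (KB * S)      ≡⟨ cong (r * (W * S) +_) (eq₁ K e KB S) ⟩
        r * (W * S) + (K * KB) * (e * S)      ≤⟨ +-monoʳ-≤ (r * (W * S)) (*-monoˡ-≤ (e * S) K≤) ⟩
        r * (W * S) + W * (e * S)             ≡⟨ eq₂ r W S e ⟩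
        W * (S * (r + e))                     ∎))

    large-degree : ∀ n e s o N → n < s + 7 * e → 8 * e ≤ o → o + s ≤ N + n → e ≤ N
    large-degree n e s o N p q r = ≤-by 1 (+-mono-≤ p (+-mono-≤ q r)) (solve (n ∷ e ∷ s ∷ o ∷ N ∷ []))

    complement-tiny : ∀ n e s r t → r + t ≡ n → s + 7 * e ≤ n → t < 2 * e → s + e ≤ r
    complement-tiny _ e s r t refl p q = ≤-by (1 + 4 * e) (+-mono-≤ p q) (solve (e ∷ s ∷ r ∷ t ∷ []))

    complement-expands : ∀ n e s r t → r + t ≡ n → s + t + e < n → s + e ≤ r
    complement-expands _ e s r t refl p = ≤-by 1 p (solve (e ∷ s ∷ r ∷ t ∷ []))

    too-few-edges : ∀ n e E K Kw → 1 ≤ e → K * K < Kw → n ≤ K * e → e * e ≤ E → n * n < Kw * E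
    too-few-edges n e@(suc _) E K Kw _ K² n≤ ee≤ = begin-strict
      n * n                  ≤⟨ *-mono-≤ n≤ n≤ ⟩
      (K * e) * (K * e)      ≡⟨ eq K e ⟩
      (K * K) * (e * e)      <⟨ *-monoˡ-< (e * e) K² ⟩
      Kw * (e * e)           ≤⟨ *-monoʳ-≤ Kw ee≤ ⟩
      Kw * E                 ∎
      where
      open ≤-Reasoning
      eq : ∀ K e → (K * e) * (K * e) ≡ (K * K) * (e * e)
      eq = solve-∀

  -- Small sets expand by the minimum in-degree; sets missing fewer than 7e vertices meet every
  -- neighbourhood in e vertices. In between, let `T` be the complement of the robust neighbourhood.
  -- It sends at most n² / Kw < e² edges into `S`, so by `edges-large` either |T| < 2e or |S| + |T|
  -- + e < n, and both mean growth by e.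
  RN-expands : ∀ {n} e K KB Kw (R : Rel n) S → DegreeCond e R → 1 ≤ e → 8 * e ≤ n → n ≤ K * e →
               K * KB ≤ Kw → K * K < Kw → K ≤ Kw → Dense KB S →
               (∀ x → RN Kw R S x ≡ true) ⊎ ♯ S + e ≤ ♯ (RN Kw R S)
  RN-expands {n} e K KB Kw R S D 1≤e 8e≤n n≤Ke KKB K² K≤ dS
    with ♯ S <? 2 * e | n <? ♯ S + 7 * e
  ... | yes S<2e | _ = inj₂ (small-expands n e (♯ S) _ K KB Kw (pos (♯ S) dS) (≤-trans (s≤s z≤n) K²) KKB n≤Ke dS
      (≤-trans (*-monoʳ-≤ Kw lower) (RN-edges Kw R S)) S<2e)
    where
    1≤n : 1 ≤ n
    1≤n = ≤-trans 1≤e (≤-trans (m≤m+n e _) 8e≤n)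
    pos : ∀ s → n ≤ KB * s → 1 ≤ s
    pos zero    h = ⊥-elim (<⇒≱ 1≤n (subst (n ≤_) (*-zeroʳ KB) h))
    pos (suc s) h = s≤s z≤n
    lower : ♯ S * (8 * e) ≤ edges R (λ _ → true) S
    lower = subst (♯ S * (8 * e) ≤_) (edges-ᵀ R (λ _ → true) S)
      (edges-rows (R ᵀ) S (λ _ → true) S (8 * e) (λ _ h → h)
        (λ y _ → ≤-trans (DegreeCond.min-in D y) (♯-mono ((R ᵀ) y) _ (λ x h → ∧-intro h refl))))
  ... | no _ | yes large = inj₁ (λ x → true-⌊⌋ (_ ≤? _)
      (≤-trans n≤Ke (*-mono-≤ K≤ (large-degree n e (♯ S) (♯ (R x)) (♯ (R x ∩ S)) large (DegreeCond.min-out D x) (♯-∩ (R x) S)))))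
  ... | no S≮2e | no n≮ with ♯ (∁ (RN Kw R S)) <? 2 * e | ♯ S + ♯ (∁ (RN Kw R S)) + e <? n
  ...   | yes q | _ = inj₂ (complement-tiny n e (♯ S) _ _ (♯-∁ (RN Kw R S)) (≮⇒≥ n≮) q)
  ...   | no _ | yes q = inj₂ (complement-expands n e (♯ S) _ _ (♯-∁ (RN Kw R S)) q)
  ...   | no p | no q = ⊥-elim (<⇒≱
      (too-few-edges n e _ K Kw 1≤e K² n≤Ke (edges-large e R (∁ (RN Kw R S)) S D 1≤e 8e≤n (≮⇒≥ p) (≮⇒≥ S≮2e) (≮⇒≥ q)))
      (edges-upper R (∁ (RN Kw R S)) S Kw n (λ x h → RN-sparse Kw R S x (not-true h))))

  level : ∀ {n} → ℕ → Rel n → Sub n → ℕ → Sub n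
  level K R S zero    = S
  level K R S (suc i) = RN K R (level K R S i)

  -- Every step gains e vertices, which also preserves the density 1 / KB, until everything is
  -- reached; from then on `RN-full` keeps it. `suc K` gains would exceed n ≤ K * e.
  level-full : ∀ {n} e K KB Kw (R : Rel n) S → DegreeCond e R → 1 ≤ e → 8 * e ≤ n → n ≤ K * e →
               K * KB ≤ Kw → K * K < Kw → K ≤ Kw → Dense KB S →
               ∀ x → level Kw R S (suc K) x ≡ true
  level-full {n} e K KB Kw R S D 1≤e 8e≤n n≤Ke KKB K² K≤ dS with grow (suc K)
    where
    dense : ∀ x → Dense Kw (R x)
    dense x = ≤-trans n≤Ke (*-mono-≤ K≤ (≤-trans (m≤m+n e _) (DegreeCond.min-out D x)))
    grow : ∀ i → (∀ x → level Kw R S i x ≡ true) ⊎ (i * e ≤ ♯ (level Kw R S i) × Dense KB (level Kw R S i))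
    grow zero = inj₂ (z≤n , dS)
    grow (suc i) with grow i
    ... | inj₁ full = inj₁ (RN-full Kw R full dense)
    ... | inj₂ (ie≤ , d) with RN-expands e K KB Kw R (level Kw R S i) D 1≤e 8e≤n n≤Ke KKB K² K≤ d
    ...   | inj₁ full = inj₁ full
    ...   | inj₂ more = inj₂ (≤-trans (≤-trans (≤-reflexive (+-comm e (i * e))) (+-monoˡ-≤ e ie≤)) more
                             , ≤-trans d (*-monoʳ-≤ KB (m+n≤o⇒m≤o _ more)))
  ... | inj₁ full = full
  ... | inj₂ (big , _) = ⊥-elim (<⇒≱ (≤-<-trans n≤Ke (+-monoˡ-≤ (K * e) 1≤e)) (≤-trans big (♯≤n (level Kw R S (suc K)))))

-- Sets with dense intersection, and blocks of the cyclic order.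

module Selection where

  open import Data.Bool using (true; false; _∧_; not)
  import Data.Bool as Bool
  open import Data.Empty using (⊥-elim)
  open import Data.Fin using (Fin; zero; suc; toℕ; fromℕ<)
  import Data.Fin as Fin
  open import Data.Fin.Properties using (any?; toℕ-fromℕ<; toℕ<n; toℕ-injective)
  open import Data.List using (List; []; _∷_; length; filter; tabulate; allFin; take)
  open import Data.List.Properties using (length-take)
  open import Data.List.Membership.Propositional using (_∉_)
  open import Data.List.Relation.Unary.All using (All; []; _∷_)
  import Data.List.Relation.Unary.All as All
  import Data.List.Relation.Unary.All.Properties as Allₚ
  open import Data.List.Relation.Unary.AllPairs using (AllPairs; []; _∷_)
  import Data.List.Relation.Unary.AllPairs.Properties as AllPairsₚ
  open import Data.List.Relation.Unary.Any using (here; there)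
  open import Data.List.Relation.Binary.Sublist.Propositional using (_⊆_; []; _∷_; _∷ʳ_; minimum)
  open import Data.List.Relation.Binary.Sublist.Propositional.Properties using (All-resp-⊆)
  open import Data.Nat
  open import Data.List.Membership.DecPropositional _≟_ using (_∈?_)
  open import Data.Nat.DivMod using (m≡m%n+[m/n]*n; m%n<n; m/n*n≤m; /-monoˡ-≤)
  open import Data.Nat.Properties
  open import Data.Nat.Tactic.RingSolver using (solve-∀)
  open import Data.Product using (∃; _×_; _,_; proj₁; proj₂)
  open import Data.Sum using (_⊎_; inj₁; inj₂)
  open import Function using (_∘_)
  open import Relation.Binary.PropositionalEquality
  open import Relation.Nullary.Decidable using (⌊_⌋; yes; no; Dec; ¬?; _×-dec_)
  open Counting
  open Expansion using (⌊⌋-true; true-⌊⌋)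
  open Levels

  AllPairs-resp-⊆ : ∀ {A : Set} {R : A → A → Set} {xs ys : List A} → xs ⊆ ys → AllPairs R ys → AllPairs R xs
  AllPairs-resp-⊆ []         []       = []
  AllPairs-resp-⊆ (_ ∷ʳ p)   (_ ∷ rs) = AllPairs-resp-⊆ p rs
  AllPairs-resp-⊆ (refl ∷ p) (r ∷ rs) = All-resp-⊆ p r ∷ AllPairs-resp-⊆ p rs

  private variable
    n : ℕ
    Z : Set

  common : (Z → Sub n) → List Z → Sub n
  common S []       w = true
  common S (z ∷ zs) w = S z w ∧ common S zs w

  common-resp-⊆ : ∀ (S : Z → Sub n) {ys zs} → ys ⊆ zs → ∀ w → common S zs w ≡ true → common S ys w ≡ true
  common-resp-⊆ S []         w h = refl
  common-resp-⊆ S (z ∷ʳ p)   w h = common-resp-⊆ S p w (proj₂ (∧-true {S z w} h))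
  common-resp-⊆ S (refl ∷ p) w h = ∧-intro (proj₁ (∧-true h)) (common-resp-⊆ S p w (proj₂ (∧-true h)))

  multiplicity : (Z → Sub n) → List Z → Fin n → ℕ
  multiplicity S []       w = 0
  multiplicity S (z ∷ zs) w = ⟦ S z w ⟧ + multiplicity S zs w

  multiplicity≤length : ∀ (S : Z → Sub n) zs w → multiplicity S zs w ≤ length zs
  multiplicity≤length S []       w = z≤n
  multiplicity≤length S (z ∷ zs) w = +-mono-≤ (⟦⟧-mono {S z w} {true} (λ _ → refl)) (multiplicity≤length S zs w)

  -- Each vertex of W lies in t of the sets; splitting W by membership in one set after another
  -- and keeping the larger part costs a factor 2 per set.
  majority : ∀ (S : Z → Sub n) zs (W : Sub n) t → (∀ w → W w ≡ true → t ≤ multiplicity S zs w) → 1 ≤ ♯ W →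
             ∃ λ ys → ys ⊆ zs × length ys ≡ t × ♯ W ≤ 2 ^ length zs * ♯ (W ∩ common S ys)
  majority S zs W zero h 1≤W = [] , minimum zs , refl ,
    (begin
      ♯ W                                  ≤⟨ ♯-mono W (W ∩ common S []) (λ w h → ∧-intro h refl) ⟩
      ♯ (W ∩ common S [])                  ≡⟨ *-identityˡ _ ⟨
      1 * ♯ (W ∩ common S [])              ≤⟨ *-monoˡ-≤ _ (m^n>0 2 (length zs)) ⟩
      2 ^ length zs * ♯ (W ∩ common S [])  ∎)
    where open ≤-Reasoning
  majority S [] W (suc t) h 1≤W with ♯-pos W 1≤W
  ... | w , Ww with () ← h w Ww
  majority S (z ∷ zs) W (suc t) h 1≤W with ≤-total (♯ (W ∩ ∁ (S z))) (♯ (W ∩ S z))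
  ... | inj₁ le = z ∷ ys , refl ∷ ys⊆zs , cong suc len ,
      ≤-trans double (≤-trans (*-monoʳ-≤ 2 (≤-trans bound (*-monoʳ-≤ (2 ^ length zs)
        (♯-mono ((W ∩ S z) ∩ common S ys) (W ∩ common S (z ∷ ys)) assoc))))
        (≤-reflexive (sym (*-assoc 2 (2 ^ length zs) _))))
    where
    W′ = W ∩ S z
    double : ♯ W ≤ 2 * ♯ W′
    double = ≤-trans (≤-reflexive (sym (♯-split W (S z))))
                     (+-monoʳ-≤ (♯ W′) (≤-trans le (≤-reflexive (sym (+-identityʳ _)))))
    pos : 1 ≤ ♯ W′
    pos with ♯ W′ | ≤-trans 1≤W double
    ... | suc _ | _ = s≤s z≤n
    rec = majority S zs W′ t
      (λ w h′ → s≤s⁻¹ (subst (λ b → suc t ≤ ⟦ b ⟧ + multiplicity S zs w) (proj₂ (∧-true {W w} h′)) (h w (proj₁ (∧-true h′))))) pos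
    ys = proj₁ rec
    ys⊆zs = proj₁ (proj₂ rec)
    len = proj₁ (proj₂ (proj₂ rec))
    bound = proj₂ (proj₂ (proj₂ rec))
    assoc : ∀ w → (W w ∧ S z w) ∧ common S ys w ≡ true → W w ∧ (S z w ∧ common S ys w) ≡ true
    assoc w h with W w | S z w
    ... | true | true = h
  ... | inj₂ le = ys , (z ∷ʳ ys⊆zs) , len ,
      ≤-trans double (≤-trans (*-monoʳ-≤ 2 (≤-trans bound (*-monoʳ-≤ (2 ^ length zs)
        (♯-mono (W′ ∩ common S ys) (W ∩ common S ys) weaken))))
        (≤-reflexive (sym (*-assoc 2 (2 ^ length zs) _))))
    where
    W′ = W ∩ ∁ (S z)
    double : ♯ W ≤ 2 * ♯ W′
    double = ≤-trans (≤-reflexive (trans (sym (♯-split W (S z))) (+-comm (♯ (W ∩ S z)) _)))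
                     (+-monoʳ-≤ (♯ W′) (≤-trans le (≤-reflexive (sym (+-identityʳ _)))))
    pos : 1 ≤ ♯ W′
    pos with ♯ W′ | ≤-trans 1≤W double
    ... | suc _ | _ = s≤s z≤n
    rec = majority S zs W′ (suc t)
      (λ w h′ → subst (λ b → suc t ≤ ⟦ b ⟧ + multiplicity S zs w) (not-true (proj₂ (∧-true {W w} h′))) (h w (proj₁ (∧-true h′)))) pos
    ys = proj₁ rec
    ys⊆zs = proj₁ (proj₂ rec)
    len = proj₁ (proj₂ (proj₂ rec))
    bound = proj₂ (proj₂ (proj₂ rec))
    weaken : ∀ w → (W w ∧ not (S z w)) ∧ common S ys w ≡ true → W w ∧ common S ys w ≡ true
    weaken w h = ∧-intro (proj₁ (∧-true (proj₁ (∧-true h)))) (proj₂ (∧-true {W w ∧ not (S z w)} h))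

  multiplicity-sum : ∀ (S : Z → Sub n) K zs → All (λ z → Dense K (S z)) zs →
                     length zs * n ≤ K * sum (multiplicity S zs)
  multiplicity-sum S K [] [] = z≤n
  multiplicity-sum {n = n} S K (z ∷ zs) (d ∷ ds) = begin
    n + length zs * n                                  ≤⟨ +-mono-≤ d (multiplicity-sum S K zs ds) ⟩
    K * ♯ (S z) + K * sum (multiplicity S zs)          ≡⟨ *-distribˡ-+ K (♯ (S z)) _ ⟨
    K * (♯ (S z) + sum (multiplicity S zs))            ≡⟨ cong (K *_) (∑-distrib-+ (λ w → ⟦ S z w ⟧) (multiplicity S zs)) ⟨
    K * sum (multiplicity S (z ∷ zs))                  ∎
    where open ≤-Reasoning

  private
    popular-bound : ∀ n q t K W s → 1 ≤ t * K → q ≡ 2 * t * K → q * n ≤ K * s → s ≤ n * t + q * W → n ≤ 2 * K * W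
    popular-bound n q t K W s 1≤tK refl h₁ h₂ = *-cancelˡ-≤ (t * K) {{>-nonZero 1≤tK}} (≤-by 0 (begin
      2 * (t * K) * n                          ≡⟨ cong (_* n) (*-assoc 2 t K) ⟨
      q * n                                    ≤⟨ h₁ ⟩
      K * s                                    ≤⟨ *-monoʳ-≤ K h₂ ⟩
      K * (n * t + q * W)                      ∎) (eq t K n W))
      where
      open ≤-Reasoning
      eq : ∀ t K n W → t * K * n + K * (n * t + 2 * t * K * W) + 0 ≡ t * K * (2 * K * W) + 2 * (t * K) * n
      eq = solve-∀

  popular : (Z → Sub n) → ℕ → List Z → Sub n
  popular S t zs w = ⌊ t ≤? multiplicity S zs w ⌋

  -- Double counting of incidences between vertices and sets: q = 2tK sets have at least qn / K =
  -- 2tn of them, the unpopular vertices account for at most tn, and each popular one for at most q.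
  popular-dense : ∀ (S : Z → Sub n) K t zs → 1 ≤ t * K → length zs ≡ 2 * t * K →
                  All (λ z → Dense K (S z)) zs → Dense (2 * K) (popular S t zs)
  popular-dense {n = n} S K t zs 1≤tK len ds =
    popular-bound n q t K (♯ W) _ 1≤tK len (multiplicity-sum S K zs ds) (begin
      sum (multiplicity S zs)                      ≤⟨ sum-mono _ _ pt ⟩
      sum (λ w → t + q * ⟦ W w ⟧)                  ≡⟨ ∑-distrib-+ (λ _ → t) (λ w → q * ⟦ W w ⟧) ⟩
      sum {n} (λ _ → t) + sum (λ w → q * ⟦ W w ⟧)  ≡⟨ cong₂ _+_ (sum-const n t) (sym (*-distribˡ-sum q (λ w → ⟦ W w ⟧))) ⟩
      n * t + q * ♯ W                              ∎)
    where
    open ≤-Reasoning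
    W = popular S t zs
    q = length zs
    pt : ∀ w → multiplicity S zs w ≤ t + q * ⟦ W w ⟧
    pt w with t ≤? multiplicity S zs w
    ... | yes _ = ≤-trans (multiplicity≤length S zs w) (≤-trans (≤-reflexive (sym (*-identityʳ q))) (m≤n+m _ t))
    ... | no ¬p = ≤-trans (<⇒≤ (≰⇒> ¬p)) (m≤m+n t _)

  dense⇒pos : ∀ K (A : Sub n) → 1 ≤ n → Dense K A → 1 ≤ ♯ A
  dense⇒pos {n} K A 1≤n d with ♯ A
  ... | zero  = ⊥-elim (<⇒≱ 1≤n (subst (n ≤_) (*-zeroʳ K) d))
  ... | suc _ = s≤s z≤n

  abstract
    -- The factor 2K is the loss in passing to the popular vertices, the power of two the loss in
    -- splitting them by membership in each of the 2tK sets.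
    boost : ℕ → ℕ → ℕ
    boost t K = 2 ^ (2 * t * K) * (2 * K)

    boost-def : ∀ t K → boost t K ≡ 2 ^ (2 * t * K) * (2 * K)
    boost-def t K = refl

  -- Every popular vertex lies in t of the sets, but which t varies with the vertex; majority
  -- splitting finds one choice that serves a constant fraction of them.
  dense-intersection : ∀ (S : Z → Sub n) K t zs → 1 ≤ n → 1 ≤ t * K → length zs ≡ 2 * t * K →
                       All (λ z → Dense K (S z)) zs →
                       ∃ λ ys → ys ⊆ zs × length ys ≡ t × Dense (boost t K) (common S ys)
  dense-intersection {n = n} S K t zs 1≤n 1≤tK len ds
    with majority S zs (popular S t zs) t (λ w → ⌊⌋-true (_ ≤? _))
           (dense⇒pos (2 * K) (popular S t zs) 1≤n (popular-dense S K t zs 1≤tK len ds))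
  ... | ys , ys⊆zs , ly , bound = ys , ys⊆zs , ly , (begin
      n                                             ≤⟨ popular-dense S K t zs 1≤tK len ds ⟩
      2 * K * ♯ W                                   ≤⟨ *-monoʳ-≤ (2 * K) bound ⟩
      2 * K * (2 ^ q * ♯ (W ∩ common S ys))         ≤⟨ *-monoʳ-≤ (2 * K) (*-monoʳ-≤ (2 ^ q)
                                                         (♯-mono (W ∩ common S ys) (common S ys) (λ w h → proj₂ (∧-true {W w} h)))) ⟩
      2 * K * (2 ^ q * ♯ (common S ys))             ≡⟨ *-assoc (2 * K) (2 ^ q) _ ⟨
      2 * K * 2 ^ q * ♯ (common S ys)               ≡⟨ cong (_* ♯ (common S ys)) (trans (*-comm (2 * K) _)
                                                         (trans (cong (λ q → 2 ^ q * (2 * K)) len) (sym (boost-def t K)))) ⟩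
      boost t K * ♯ (common S ys)                   ∎)
    where
    open ≤-Reasoning
    W = popular S t zs
    q = length zs

  ♯-cover : ∀ {m} (A : Sub n) (f : Fin n → Fin m) → ♯ A ≤ sum (λ c → ♯ (A ∩ λ x → ⌊ f x Fin.≟ c ⌋))
  ♯-cover A f = begin
    ♯ A                                                     ≤⟨ sum-mono _ _ pt ⟩
    sum (λ x → ♯ (λ c → A x ∧ ⌊ f x Fin.≟ c ⌋))             ≡⟨ ∑-comm (λ x c → ⟦ A x ∧ ⌊ f x Fin.≟ c ⌋ ⟧) ⟩
    sum (λ c → ♯ (A ∩ λ x → ⌊ f x Fin.≟ c ⌋))               ∎
    where
    open ≤-Reasoning
    pt : ∀ x → ⟦ A x ⟧ ≤ ♯ (λ c → A x ∧ ⌊ f x Fin.≟ c ⌋)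
    pt x with A x
    ... | false = z≤n
    ... | true  = ♯-member (λ c → ⌊ f x Fin.≟ c ⌋) (f x) (true-⌊⌋ (_ Fin.≟ _) refl)

  ♯-subsingleton : ∀ (A : Sub n) → (∀ x y → A x ≡ true → A y ≡ true → x ≡ y) → ♯ A ≤ 1
  ♯-subsingleton {zero}  A h = z≤n
  ♯-subsingleton {suc n} A h with A zero in eq
  ... | false = ♯-subsingleton (A ∘ suc) (λ x y p q → Data.Fin.Properties.suc-injective (h (suc x) (suc y) p q))
  ... | true  = s≤s (≤-reflexive (trans (sum-cong-≗ (λ x → none x)) (trans (sum-const n 0) (*-zeroʳ n))))
    where
    none : ∀ x → ⟦ A (suc x) ⟧ ≡ 0
    none x with A (suc x) in eq′
    ... | false = refl
    ... | true with () ← h zero (suc x) eq eq′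

  ♯-injective : ∀ {m} (A : Sub n) (f : Fin n → Fin m) →
                (∀ x y → A x ≡ true → A y ≡ true → f x ≡ f y → x ≡ y) → ♯ A ≤ m
  ♯-injective {m = m} A f h = ≤-trans (♯-cover A f) (≤-trans (sum-mono {m} _ _ (λ c → ♯-subsingleton (A ∩ λ x → ⌊ f x Fin.≟ c ⌋) (λ x y p q →
      h x y (proj₁ (∧-true p)) (proj₁ (∧-true q))
        (trans (⌊⌋-true (_ Fin.≟ _) (proj₂ (∧-true {A x} p))) (sym (⌊⌋-true (_ Fin.≟ _) (proj₂ (∧-true {A y} q))))))))
    (≤-reflexive (trans (sum-const m 1) (*-identityʳ m))))

  union : ∀ {P Q R : Set} (p : Dec P) (q : Dec Q) (r : Dec R) → (P → Q ⊎ R) → ⟦ ⌊ p ⌋ ⟧ ≤ ⟦ ⌊ q ⌋ ⟧ + ⟦ ⌊ r ⌋ ⟧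
  union (no _)  _       _       _ = z≤n
  union (yes _) (yes _) _       _ = s≤s z≤n
  union (yes _) (no _)  (yes _) _ = ≤-refl
  union (yes p) (no ¬q) (no ¬r) f with f p
  ... | inj₁ q = ⊥-elim (¬q q)
  ... | inj₂ r = ⊥-elim (¬r r)

  listed : ∀ (F : List ℕ) m → ♯ {m} (λ c → ⌊ toℕ c ∈? F ⌋) ≤ length F
  listed []      m = ≤-reflexive (trans (sum-const m 0) (*-zeroʳ m))
  listed (b ∷ F) m = begin
    ♯ {m} (λ c → ⌊ toℕ c ∈? b ∷ F ⌋)                          ≤⟨ sum-mono _ _ pt ⟩
    sum {m} (λ c → ⟦ ⌊ toℕ c ≟ b ⌋ ⟧ + ⟦ ⌊ toℕ c ∈? F ⌋ ⟧)    ≡⟨ ∑-distrib-+ {m} (λ c → ⟦ ⌊ toℕ c ≟ b ⌋ ⟧) (λ c → ⟦ ⌊ toℕ c ∈? F ⌋ ⟧) ⟩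
    ♯ {m} (λ c → ⌊ toℕ c ≟ b ⌋) + ♯ {m} (λ c → ⌊ toℕ c ∈? F ⌋)
      ≤⟨ +-mono-≤ (♯-subsingleton {m} (λ c → ⌊ toℕ c ≟ b ⌋) (λ x y p q → toℕ-injective (trans (⌊⌋-true (_ ≟ _) p) (sym (⌊⌋-true (_ ≟ _) q)))))
                  (listed F m) ⟩
    1 + length F                                              ∎
    where
    open ≤-Reasoning
    pt : ∀ (c : Fin m) → ⟦ ⌊ toℕ c ∈? b ∷ F ⌋ ⟧ ≤ ⟦ ⌊ toℕ c ≟ b ⌋ ⟧ + ⟦ ⌊ toℕ c ∈? F ⌋ ⟧
    pt c = union (toℕ c ∈? b ∷ F) (toℕ c ≟ b) (toℕ c ∈? F) λ { (here p) → inj₁ p ; (there p) → inj₂ p }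

  module _ (L : ℕ) .{{_ : NonZero L}} where

    -- Elements of `Fin n` are positions on the cyclic order, so blocks are intervals of it.
    block : Fin n → ℕ
    block x = toℕ x / L

    private
      blocks-bound : ∀ n K L q f d a → n ≤ K * a → a ≤ L * f + suc d * q → 2 * q * K ≤ L → d * L ≤ n → n ≤ L + 2 * K * f * L
      blocks-bound n K L q f d a h₁ h₂ h₃ h₄ = ≤-by 0 (begin
        2 * n                                   ≤⟨ *-monoʳ-≤ 2 h₁ ⟩
        2 * (K * a)                             ≤⟨ *-monoʳ-≤ 2 (*-monoʳ-≤ K h₂) ⟩
        2 * (K * (L * f + suc d * q))           ≡⟨ eq K L f d q ⟩
        2 * K * f * L + suc d * (2 * q * K)     ≤⟨ +-monoʳ-≤ (2 * K * f * L) (*-monoʳ-≤ (suc d) h₃) ⟩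
        2 * K * f * L + (L + d * L)             ≤⟨ +-monoʳ-≤ (2 * K * f * L) (+-monoʳ-≤ L h₄) ⟩
        2 * K * f * L + (L + n)                 ∎) (eq′ n (2 * K * f * L) L)
        where
        open ≤-Reasoning
        eq : ∀ K L f d q → 2 * (K * (L * f + suc d * q)) ≡ 2 * K * f * L + suc d * (2 * q * K)
        eq = solve-∀
        eq′ : ∀ n X L → n + (X + (L + n)) + 0 ≡ L + X + 2 * n
        eq′ = solve-∀

    -- Otherwise `A` has at most `L` elements in each of the f forbidden blocks and fewer than q in
    -- each of the at most n / L + 1 others. As 2qK ≤ L, the latter are at most (n + L) / (2K) in
    -- total, and density of `A` yields n ≤ L + 2KfL.
    free-block : ∀ K q f (A : Sub n) (F : List ℕ) → length F ≤ f → 2 * q * K ≤ L → L + 2 * K * f * L < n → Dense K A →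
                 ∃ λ β → β ∉ F × q ≤ ♯ (A ∩ λ x → ⌊ block x ≟ β ⌋)
    free-block {n} K q f A F lF 2qK≤L large dA
      with any? {suc (n / L)} (λ c → ¬? (toℕ c ∈? F) ×-dec q ≤? ♯ (A ∩ λ x → ⌊ block x ≟ toℕ c ⌋))
    ... | yes (c , p) = toℕ c , p
    ... | no none = ⊥-elim (<⇒≱ large (blocks-bound n K L q f (n / L) (♯ A) dA upper 2qK≤L (m/n*n≤m n L)))
      where
      m = suc (n / L)
      blk : Fin n → Fin m
      blk x = fromℕ< (s≤s (/-monoˡ-≤ L (<⇒≤ (toℕ<n x))))
      pos : Fin n → Fin L
      pos x = fromℕ< (m%n<n (toℕ x) L)
      same : ∀ x c → ⌊ blk x Fin.≟ c ⌋ ≡ true → block x ≡ toℕ c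
      same x c p = trans (sym (toℕ-fromℕ< _)) (cong toℕ (⌊⌋-true (_ Fin.≟ _) p))
      small : ∀ c → ♯ (A ∩ λ x → ⌊ blk x Fin.≟ c ⌋) ≤ L
      small c = ♯-injective _ pos (λ x y p q e → toℕ-injective (begin
        toℕ x                              ≡⟨ m≡m%n+[m/n]*n (toℕ x) L ⟩
        toℕ x % L + block x * L            ≡⟨ cong₂ (λ r d → r + d * L)
                                                (trans (sym (toℕ-fromℕ< _)) (trans (cong toℕ e) (toℕ-fromℕ< _)))
                                                (trans (same x c (proj₂ (∧-true {A x} p))) (sym (same y c (proj₂ (∧-true {A y} q))))) ⟩
        toℕ y % L + block y * L            ≡⟨ m≡m%n+[m/n]*n (toℕ y) L ⟨
        toℕ y                              ∎))
        where open ≡-Reasoning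
      pt : ∀ c → ♯ (A ∩ λ x → ⌊ blk x Fin.≟ c ⌋) ≤ L * ⟦ ⌊ toℕ c ∈? F ⌋ ⟧ + q
      pt c with toℕ c ∈? F | q ≤? ♯ (A ∩ λ x → ⌊ block x ≟ toℕ c ⌋) in eq
      ... | yes _ | _      = ≤-trans (small c) (≤-trans (≤-reflexive (sym (*-identityʳ L))) (m≤m+n _ q))
      ... | no c∉ | yes q≤ = ⊥-elim (none (c , c∉ , q≤))
      ... | no _  | no q≰  = ≤-trans (♯-mono (A ∩ λ x → ⌊ blk x Fin.≟ c ⌋) (A ∩ λ x → ⌊ block x ≟ toℕ c ⌋)
                               (λ x p → ∧-intro (proj₁ (∧-true p)) (true-⌊⌋ (_ ≟ _) (same x c (proj₂ (∧-true {A x} p))))))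
                               (≤-trans (<⇒≤ (≰⇒> q≰)) (m≤n+m q _))
      upper : ♯ A ≤ L * f + m * q
      upper = begin
        ♯ A                                                       ≤⟨ ♯-cover A blk ⟩
        sum (λ c → ♯ (A ∩ λ x → ⌊ blk x Fin.≟ c ⌋))               ≤⟨ sum-mono _ _ pt ⟩
        sum {m} (λ c → L * ⟦ ⌊ toℕ c ∈? F ⌋ ⟧ + q)                ≡⟨ ∑-distrib-+ {m} (λ c → L * ⟦ ⌊ toℕ c ∈? F ⌋ ⟧) (λ _ → q) ⟩
        sum {m} (λ c → L * ⟦ ⌊ toℕ c ∈? F ⌋ ⟧) + sum {m} (λ _ → q)
          ≡⟨ cong₂ _+_ (sym (*-distribˡ-sum {m} L (λ c → ⟦ ⌊ toℕ c ∈? F ⌋ ⟧))) (sum-const m q) ⟩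
        L * ♯ {m} (λ c → ⌊ toℕ c ∈? F ⌋) + m * q                  ≤⟨ +-monoˡ-≤ (m * q) (*-monoʳ-≤ L (≤-trans (listed F m) lF)) ⟩
        L * f + m * q                                             ∎
        where open ≤-Reasoning

  elements : Sub n → List (Fin n)
  elements A = filter (λ x → A x Bool.≟ true) (allFin _)

  length-filter-tabulate : ∀ {m} (A : Sub n) (f : Fin m → Fin n) →
                           length (filter (λ x → A x Bool.≟ true) (tabulate f)) ≡ sum (λ i → ⟦ A (f i) ⟧)
  length-filter-tabulate {m = zero}  A f = refl
  length-filter-tabulate {m = suc m} A f with A (f zero)
  ... | true  = cong suc (length-filter-tabulate A (f ∘ suc))
  ... | false = length-filter-tabulate A (f ∘ suc)

  length-elements : ∀ (A : Sub n) → length (elements A) ≡ ♯ A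
  length-elements A = length-filter-tabulate A (λ x → x)

  some-elements : ∀ (A : Sub n) q → q ≤ ♯ A → ∃ λ xs → length xs ≡ q × AllPairs Fin._<_ xs × All (λ x → A x ≡ true) xs
  some-elements A q q≤ = take q (elements A)
    , trans (length-take q (elements A)) (trans (cong (q ⊓_) (length-elements A)) (m≤n⇒m⊓n≡m q≤))
    , AllPairsₚ.take⁺ q (AllPairsₚ.filter⁺ (λ x → A x Bool.≟ true) (AllPairsₚ.tabulate⁺-< (λ i<j → i<j)))
    , Allₚ.take⁺ q (Allₚ.all-filter (λ x → A x Bool.≟ true) (allFin _))

-- Closed chains of completely joined triples.

module Chains where

  open import Data.Bool using (true; _∧_)
  open import Data.Empty using (⊥-elim)
  open import Data.Fin using (Fin)
  import Data.Fin as Fin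
  open import Data.List using (List; []; _∷_; length)
  open import Data.List.Membership.Propositional using (_∉_)
  open import Data.List.Relation.Unary.All using ([]; _∷_)
  import Data.List.Relation.Unary.All as All
  open import Data.List.Relation.Unary.AllPairs using ([]; _∷_)
  open import Data.List.Relation.Unary.Any using (here; there)
  open import Data.List.Relation.Binary.Sublist.Propositional using (⊆-trans)
  open import Data.List.Relation.Binary.Sublist.Propositional.Properties using (All-resp-⊆)
  open import Data.Nat
  open import Data.Nat.Properties
  open import Data.Product using (∃; Σ; _×_; _,_; proj₁; proj₂)
  open import Function using (_∘_)
  open import Relation.Binary.PropositionalEquality
  open import Relation.Nullary.Decidable using (⌊_⌋)
  open Counting
  open Expansion
  open Levels
  open Selection

  record Triple (n : ℕ) : Set where
    field
      x y z : Fin n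

  open Triple public

  data _∈ₜ_ {n} : Fin n → Triple n → Set where
    is-x : ∀ {t} → x t ∈ₜ t
    is-y : ∀ {t} → y t ∈ₜ t
    is-z : ∀ {t} → z t ∈ₜ t

  Ascending : ∀ {n} → Triple n → Set
  Ascending t = x t Fin.< y t × y t Fin.< z t

  abstract
    -- Enough for two applications of `dense-intersection`: the first keeps 2 * 3 * K sets, which is
    -- the number from which the second extracts 3.
    breadth : ℕ → ℕ
    breadth K = 2 * (2 * 3 * K) * K

    breadth-def : ∀ K → breadth K ≡ 2 * (2 * 3 * K) * K
    breadth-def K = refl

  outK inK : ℕ → ℕ
  outK K = boost (2 * 3 * K) K
  inK K = boost 3 K

  module _ (L : ℕ) .{{_ : NonZero L}} where

    -- Inside one free block, `S₁` first reduces many vertices to 6K with a dense common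
    -- neighbourhood, then `S₂` reduces these to three. Both resulting densities depend on `K` and
    -- not on the density `KA` of the set `A`, so that choices can be repeated without loss.
    pick : ∀ {n} K KA f (A : Sub n) F (S₁ S₂ : Rel n) → 1 ≤ K → 1 ≤ n →
           length F ≤ f → 2 * breadth K * KA ≤ L → L + 2 * KA * f * L < n → Dense KA A →
           (∀ u → A u ≡ true → Dense K (S₁ u)) → (∀ u → A u ≡ true → Dense K (S₂ u)) →
           ∃ λ t → ∃ λ β → Ascending t × β ∉ F × (∀ {u} → u ∈ₜ t → A u ≡ true × block L u ≡ β) ×
           (∃ λ C → Dense (outK K) C × (∀ {u w} → u ∈ₜ t → C w ≡ true → S₁ u w ≡ true)) ×
           (∃ λ C → Dense (inK K) C × (∀ {u w} → u ∈ₜ t → C w ≡ true → S₂ u w ≡ true))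
    pick K@(suc _) KA f A F S₁ S₂ 1≤K 1≤n lF size large dA d₁ d₂
      with free-block L KA (breadth K) f A F lF size large dA
    ... | β , β∉F , many
      with some-elements (A ∩ λ u → ⌊ block L u ≟ β ⌋) (breadth K) many
    ... | us , lus , us< , us∈
      with dense-intersection S₁ K (2 * 3 * K) us 1≤n (s≤s z≤n) (trans lus (breadth-def K)) (All.map (λ {u} h → d₁ u (proj₁ (∧-true {A u} h))) us∈)
    ... | ys , ys⊆us , lys , dys
      with dense-intersection S₂ K 3 ys 1≤n (s≤s z≤n) lys
             (All.map (λ {u} h → d₂ u (proj₁ (∧-true {A u} h))) (All-resp-⊆ ys⊆us us∈))
    ... | a ∷ b ∷ c ∷ [] , ts⊆ys , refl , dts
      with AllPairs-resp-⊆ (⊆-trans ts⊆ys ys⊆us) us< | All-resp-⊆ (⊆-trans ts⊆ys ys⊆us) us∈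
    ... | (a<b ∷ _) ∷ (b<c ∷ []) ∷ _ | ha ∷ hb ∷ hc ∷ [] =
      t , β , (a<b , b<c) , β∉F , (λ { is-x → both a ha ; is-y → both b hb ; is-z → both c hc }) ,
      (common S₁ ys , dys , λ u∈ Cw → member S₁ u∈ (common-resp-⊆ S₁ ts⊆ys _ Cw)) ,
      (common S₂ (a ∷ b ∷ c ∷ []) , dts , λ u∈ Cw → member S₂ u∈ Cw)
      where
      t : Triple _
      t = record { x = a ; y = b ; z = c }
      both : ∀ u → A u ∧ ⌊ block L u ≟ β ⌋ ≡ true → A u ≡ true × block L u ≡ β
      both u h = proj₁ (∧-true h) , ⌊⌋-true (_ ≟ _) (proj₂ (∧-true {A u} h))
      member : ∀ (S : Rel _) {u w} → u ∈ₜ t → common S (a ∷ b ∷ c ∷ []) w ≡ true → S u w ≡ true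
      member S {w = w} is-x h = proj₁ (∧-true h)
      member S {w = w} is-y h = proj₁ (∧-true (proj₂ (∧-true {S a w} h)))
      member S {w = w} is-z h = proj₁ (∧-true (proj₂ (∧-true {S b w} (proj₂ (∧-true {S a w} h)))))

    -- `T` and `β` are total functions that matter only up to `l`, which avoids casts between finite
    -- index types. `F` lists the blocks occupied elsewhere.
    record Chain {n} (H : Rel n) (F : List ℕ) (l : ℕ) : Set where
      field
        T         : ℕ → Triple n
        β         : ℕ → ℕ
        ascending : ∀ j → j ≤ l → Ascending (T j)
        in-block  : ∀ j → j ≤ l → ∀ {u} → u ∈ₜ T j → block L u ≡ β j
        fresh     : ∀ j → j ≤ l → β j ∉ F
        distinct  : ∀ i j → i ≤ l → j ≤ l → β i ≡ β j → i ≡ j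
        joined    : ∀ j → j < l → ∀ {u w} → u ∈ₜ T j → w ∈ₜ T (suc j) → H u w ≡ true

    module _ {n : ℕ} {H : Rel n} {F : List ℕ} where
      open Chain

      single : ∀ t b → Ascending t → b ∉ F → (∀ {u} → u ∈ₜ t → block L u ≡ b) → Chain H F 0
      single t b asc b∉ blk = record
        { T = λ _ → t ; β = λ _ → b
        ; ascending = λ _ _ → asc
        ; in-block = λ _ _ → blk
        ; fresh = λ _ _ → b∉
        ; distinct = λ { zero zero _ _ _ → refl }
        ; joined = λ _ () }

      cons : ∀ {l} t b → Ascending t → b ∉ F → (∀ {u} → u ∈ₜ t → block L u ≡ b) →
             (c : Chain H (b ∷ F) l) → (∀ {u w} → u ∈ₜ t → w ∈ₜ T c 0 → H u w ≡ true) → Chain H F (suc l)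
      cons {l} t b asc b∉ blk c join = record
        { T = λ { zero → t ; (suc j) → T c j }
        ; β = β′
        ; ascending = λ { zero _ → asc ; (suc j) (s≤s h) → ascending c j h }
        ; in-block = λ { zero _ → blk ; (suc j) (s≤s h) → in-block c j h }
        ; fresh = λ { zero _ → b∉ ; (suc j) (s≤s h) p → fresh c j h (there p) }
        ; distinct = dist
        ; joined = λ { zero _ → join ; (suc j) (s≤s h) → joined c j h } }
        where
        β′ : ℕ → ℕ
        β′ zero    = b
        β′ (suc j) = β c j
        dist : ∀ i j → i ≤ suc l → j ≤ suc l → β′ i ≡ β′ j → i ≡ j
        dist zero    zero    _       _       _ = refl
        dist zero    (suc j) _       (s≤s h) e = ⊥-elim (fresh c j h (here (sym e)))
        dist (suc i) zero    (s≤s h) _       e = ⊥-elim (fresh c i h (here e))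
        dist (suc i) (suc j) (s≤s h) (s≤s k) e = cong suc (distinct c i j h k e)

    -- `G i` is thought of as the vertices from which i robust steps lead into `G 0`, and class j is
    -- chosen inside `G (l - j)`. The set for the next choice is the common part of all `H u ∩ G l`,
    -- u in the new class; its density is `outK K` again, whatever that of `A` was.
    chain : ∀ {n} (H : Rel n) K KA f l (G : ℕ → Sub n) A F → 1 ≤ K → 1 ≤ n → outK K ≤ KA →
            2 * breadth K * KA ≤ L → L + 2 * KA * f * L < n → length F + l ≤ f →
            (∀ j u → G (suc j) u ≡ true → Dense K (H u ∩ G j)) →
            Dense KA A → (∀ u → A u ≡ true → G l u ≡ true) →
            Σ (Chain H F l) λ c → (∀ {u} → u ∈ₜ Chain.T c 0 → A u ≡ true) ×
              (∀ j i → j + i ≡ l → ∀ {u} → u ∈ₜ Chain.T c j → G i u ≡ true)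
    chain {n} H K KA f zero G A F 1≤K 1≤n out≤ size large lF step dA A⊆G
      -- The last class has no successor to provide for, so both relations are the full one.
      with pick K KA f A F (λ _ _ → true) (λ _ _ → true) 1≤K 1≤n (m+n≤o⇒m≤o _ lF) size large dA (λ _ _ → all) (λ _ _ → all)
      where
      all : Dense {n} K (λ _ → true)
      all = ≤-trans (≤-reflexive (trans (sym (♯-full n)) (sym (*-identityˡ _)))) (*-monoˡ-≤ _ 1≤K)
    ... | t , b , asc , b∉ , h , _ = single t b asc b∉ (λ u∈ → proj₂ (h u∈)) , (λ u∈ → proj₁ (h u∈)) ,
          λ { zero zero _ u∈ → A⊆G _ (proj₁ (h u∈)) }
    chain H K KA f (suc l) G A F 1≤K 1≤n out≤ size large lF step dA A⊆G
      with pick K KA f A F (λ u → H u ∩ G l) (λ u → H u ∩ G l) 1≤K 1≤n (m+n≤o⇒m≤o _ lF) size large dA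
             (λ u Au → step l u (A⊆G u Au)) (λ u Au → step l u (A⊆G u Au))
    ... | t , b , asc , b∉ , h , (C , dC , hC) , _
      with chain H K KA f l G (C ∩ G l) (b ∷ F) 1≤K 1≤n out≤ size large
             (≤-trans (≤-reflexive (sym (+-suc (length F) l))) lF) step
             (Dense-mono C (C ∩ G l) out≤ (λ w Cw → ∧-intro Cw (proj₂ (∧-true {H (x t) w} (hC is-x Cw)))) dC)
             (λ w p → proj₂ (∧-true {C w} p))
    ... | c , c⊆ , cG = cons t b asc b∉ (λ u∈ → proj₂ (h u∈)) c
            (λ {u} {w} u∈ w∈ → proj₁ (∧-true (hC u∈ (proj₁ (∧-true {C w} (c⊆ w∈)))))) ,
          (λ u∈ → proj₁ (h u∈)) ,
          λ { zero .(suc l) refl u∈ → A⊆G _ (proj₁ (h u∈)) ; (suc j) i e u∈ → cG j i (suc-injective e) u∈ }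

  -- `f` is in force up to and including index r; index r + 1 is `g 0`.
  glue : ∀ {A : Set} → ℕ → (ℕ → A) → (ℕ → A) → ℕ → A
  glue r       f g zero    = f 0
  glue zero    f g (suc i) = g i
  glue (suc r) f g (suc i) = glue r (f ∘ suc) g i

  glue-right : ∀ {A : Set} r (f g : ℕ → A) i → glue r f g (suc r + i) ≡ g i
  glue-right zero    f g i = refl
  glue-right (suc r) f g i = glue-right r (f ∘ suc) g i

  glue-step : ∀ {A : Set} (R : A → A → Set) r f g → (∀ i → R (f i) (f (suc i))) → (∀ i → R (g i) (g (suc i))) →
              R (f r) (g 0) → ∀ i → R (glue r f g i) (glue r f g (suc i))
  glue-step R zero    f g hf hg link zero    = link
  glue-step R zero    f g hf hg link (suc i) = hg i
  glue-step R (suc r) f g hf hg link zero    = subst (R (f 0)) (sym (glue-0 r)) (hf 0)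
    where
    glue-0 : ∀ r → glue r (f ∘ suc) g 0 ≡ f 1
    glue-0 zero    = refl
    glue-0 (suc r) = refl
  glue-step R (suc r) f g hf hg link (suc i) = glue-step R r (f ∘ suc) g (hf ∘ suc) hg link i

  module Constants (K : ℕ) where
    -- `r` robust steps lead everywhere. A walk through `N⁻(v)` back to `T 0` has r + 1 goals on
    -- either side, numbered from 0 to `l`. `f` counts the occupied blocks: those of `v`, of `T 0`
    -- and of l further classes.
    KB r l f : ℕ
    KB = inK K
    r  = suc K
    l  = suc r + r
    f  = 2 + l

    abstract
      -- `Kw` is at least K * KB for the expansion of small sets and above K * K for the edge count
      -- of the others. `KA` allows choices in the common out-neighbourhood of `T 0` and in those of
      -- later classes. `L` and `n₀` meet the two size requirements of `free-block`.
      Kw KA L n₀ : ℕ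
      Kw = suc (K * KB + K * K + K)
      KA = outK K + outK Kw
      L  = suc (2 * breadth K * KA + 2 * breadth Kw * KA)
      n₀ = suc (L + 2 * KA * f * L)

      instance
        L≢0 : NonZero L
        L≢0 = _

      K*KB≤Kw : K * KB ≤ Kw
      K*KB≤Kw = m≤n⇒m≤1+n (≤-trans (m≤m+n (K * KB) (K * K)) (m≤m+n _ K))

      K*K<Kw : K * K < Kw
      K*K<Kw = s≤s (≤-trans (m≤n+m (K * K) (K * KB)) (m≤m+n _ K))

      K≤Kw : K ≤ Kw
      K≤Kw = m≤n⇒m≤1+n (m≤n+m K _)

      outK≤KA : outK K ≤ KA
      outK≤KA = m≤m+n _ _

      outKw≤KA : outK Kw ≤ KA
      outKw≤KA = m≤n+m _ (outK K)

      breadth≤L : 2 * breadth K * KA ≤ L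
      breadth≤L = m≤n⇒m≤1+n (m≤m+n _ _)

      breadthw≤L : 2 * breadth Kw * KA ≤ L
      breadthw≤L = m≤n⇒m≤1+n (m≤n+m _ (2 * breadth K * KA))

      n₀-large : L + 2 * KA * f * L < n₀
      n₀-large = ≤-refl

  module _ {n : ℕ} (K e : ℕ) (H : Rel n) (D : DegreeCond e H)
           (1≤K : 1 ≤ K) (1≤e : 1 ≤ e) (8e≤n : 8 * e ≤ n) (n≤Ke : n ≤ K * e) where
    open Constants K

    private
      1≤n : 1 ≤ n
      1≤n = ≤-trans (≤-trans 1≤e (m≤m+n e _)) 8e≤n

      K≤boost : ∀ t → K ≤ boost t K
      K≤boost t = begin
        K                                ≤⟨ m≤m+n K _ ⟩
        2 * K                            ≡⟨ *-identityˡ (2 * K) ⟨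
        1 * (2 * K)                      ≤⟨ *-monoˡ-≤ (2 * K) (m^n>0 2 (2 * t * K)) ⟩
        2 ^ (2 * t * K) * (2 * K)        ≡⟨ boost-def t K ⟨
        boost t K                        ∎
        where open ≤-Reasoning

      1≤Kw : 1 ≤ Kw
      1≤Kw = ≤-trans 1≤K K≤Kw

      out-dense : ∀ u → Dense K (H u)
      out-dense u = ≤-trans n≤Ke (*-monoʳ-≤ K (≤-trans (m≤m+n e _) (DegreeCond.min-out D u)))

      in-dense : ∀ u → Dense K ((H ᵀ) u)
      in-dense u = ≤-trans n≤Ke (*-monoʳ-≤ K (≤-trans (m≤m+n e _) (DegreeCond.min-in D u)))

      levels-full : ∀ KB′ S → K * KB′ ≤ Kw → Dense KB′ S → ∀ u → level Kw H S r u ≡ true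
      levels-full KB′ S le = level-full e K KB′ Kw H S D 1≤e 8e≤n n≤Ke le K*K<Kw K≤Kw

      module _ (v : Fin n) (B : Sub n) (dB : Dense KB B) where
        -- Traversed from `l` down to 0: `goal l` is everything, `goal (suc r)` is the
        -- in-neighbourhood of `v`, `goal r` is everything again, and `goal 0` is `B`. Since
        -- `goal r` is full, a vertex of the in-neighbourhood of `v` can be left in any direction,
        -- which links the two walks.
        goal : ℕ → Sub n
        goal = glue r (level Kw H B) (level Kw H ((H ᵀ) v))

        goal-step : ∀ j u → goal (suc j) u ≡ true → Dense Kw (H u ∩ goal j)
        goal-step = glue-step (λ S S′ → ∀ u → S′ u ≡ true → Dense Kw (H u ∩ S)) r _ _
          (λ i u → RN-dense Kw H (level Kw H B i) u) (λ i u → RN-dense Kw H (level Kw H ((H ᵀ) v) i) u)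
          (λ u _ → RN-dense Kw H (level Kw H B r) u
            (RN-full Kw H (levels-full KB B K*KB≤Kw dB)
                     (λ w → ≤-trans (out-dense w) (*-monoˡ-≤ _ K≤Kw)) u))

        goal-top : ∀ u → goal l u ≡ true
        goal-top u = trans (cong (λ S → S u) (glue-right r (level Kw H B) (level Kw H ((H ᵀ) v)) r))
          (levels-full K ((H ᵀ) v) (<⇒≤ K*K<Kw) (in-dense v) u)

    private
      return-chain : n₀ ≤ n → ∀ v B → (dB : Dense KB B) → ∀ C → Dense (outK K) C → ∀ b →
                     Σ (Chain L H (b ∷ block L v ∷ []) l) λ c → (∀ {u} → u ∈ₜ Chain.T c 0 → C u ≡ true) ×
                       (∀ j i → j + i ≡ l → ∀ {u} → u ∈ₜ Chain.T c j → goal v B dB i u ≡ true)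
      return-chain n₀≤n v B dB C dC b =
        chain L H Kw KA f l (goal v B dB) C (b ∷ block L v ∷ []) 1≤Kw 1≤n outKw≤KA
          breadthw≤L (≤-trans n₀-large n₀≤n) ≤-refl (goal-step v B dB)
          (≤-trans dC (*-monoˡ-≤ (♯ C) outK≤KA)) (λ u _ → goal-top v B dB u)

      at-N : ∀ v B dB u → goal v B dB (suc r) u ≡ H u v
      at-N v B dB u = trans (cong (λ i → goal v B dB (suc i) u) (sym (+-identityʳ r)))
                            (cong (λ S → S u) (glue-right r (level Kw H B) (level Kw H ((H ᵀ) v)) 0))

      Anchor : Fin n → Set
      Anchor v = ∃ λ t → ∃ λ b → Ascending t × b ∉ block L v ∷ [] × (∀ {u} → u ∈ₜ t → H v u ≡ true × block L u ≡ b) ×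
                 (∃ λ C → Dense (outK K) C × (∀ {u w} → u ∈ₜ t → C w ≡ true → H u w ≡ true)) ×
                 (∃ λ C → Dense (inK K) C × (∀ {u w} → u ∈ₜ t → C w ≡ true → H w u ≡ true))

      anchor : n₀ ≤ n → ∀ v → Anchor v
      anchor n₀≤n v = pick L K KA f (H v) (block L v ∷ []) H (H ᵀ) 1≤K 1≤n (s≤s z≤n)
        breadth≤L (≤-trans n₀-large n₀≤n)
        (≤-trans (out-dense v) (*-monoˡ-≤ (♯ (H v)) (≤-trans (K≤boost (2 * 3 * K)) outK≤KA)))
        (λ u _ → out-dense u) (λ u _ → in-dense u)

    Closed : (v : Fin n) → Chain L H (block L v ∷ []) (suc l) → Set
    Closed v c = (∀ {u} → u ∈ₜ T 0 → H v u ≡ true) × (∀ {u} → u ∈ₜ T (suc r) → H u v ≡ true) ×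
                 (∀ {u w} → u ∈ₜ T (suc l) → w ∈ₜ T 0 → H u w ≡ true)
      where open Chain c

    -- T 0 ⊆ N⁺(v) has dense common neighbourhoods on both sides; a robust walk leads on
    -- to T (r + 1) ⊆ N⁻(v) and another one back to the common in-neighbourhood of T 0.
    closed-chain : n₀ ≤ n → ∀ v → Σ (Chain L H (block L v ∷ []) (suc l)) (Closed v)
    closed-chain n₀≤n v = close (anchor n₀≤n v)
      where
      close : Anchor v → Σ (Chain L H (block L v ∷ []) (suc l)) (Closed v)
      close (t , b , asc , b∉ , h , (C , dC , hC) , (B , dB , hB)) = attach (return-chain n₀≤n v B dB C dC b)
        where
        attach : (Σ (Chain L H (b ∷ block L v ∷ []) l) λ c → (∀ {u} → u ∈ₜ Chain.T c 0 → C u ≡ true) ×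
                   (∀ j i → j + i ≡ l → ∀ {u} → u ∈ₜ Chain.T c j → goal v B dB i u ≡ true)) →
                 Σ (Chain L H (block L v ∷ []) (suc l)) (Closed v)
        attach (c , c⊆C , c⊆goal) =
          cons L t b asc b∉ (λ u∈ → proj₂ (h u∈)) c (λ u∈ w∈ → hC u∈ (c⊆C w∈)) ,
          (λ u∈ → proj₁ (h u∈)) ,
          (λ {u} u∈ → trans (sym (at-N v B dB u)) (c⊆goal r (suc r) (+-suc r r) u∈)) ,
          (λ u∈ w∈ → hB w∈ (c⊆goal l 0 (+-identityʳ l) u∈))

-- Orbits of injective maps, and merging cycles by exchanging images.

module Orbits where

  open import Data.Empty using (⊥-elim)
  open import Data.Fin using (Fin; toℕ; fromℕ<)
  import Data.Fin as Fin
  open import Data.Fin.Permutation using (Permutation′; _⟨$⟩ʳ_; _⟨$⟩ˡ_; permutation; transpose; _∘ₚ_; inverseˡ; inverseʳ)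
  open import Data.Fin.Properties using (any?; toℕ-fromℕ<; toℕ<n; pigeonhole)
  open import Data.List using (List; []; _∷_; cartesianProduct)
  open import Data.List.Membership.Propositional using (_∈_; find; lose)
  open import Data.List.Membership.Propositional.Properties using (∈-cartesianProduct⁺)
  open import Data.List.Relation.Unary.Any using (here; there)
  import Data.List.Relation.Unary.Any as Any
  open import Data.Nat
  open import Data.Nat.DivMod using (m≡m%n+[m/n]*n; m%n<n)
  open import Data.Nat.Properties
  open import Data.Product using (∃; Σ; _×_; _,_; proj₁; proj₂)
  open import Data.Sum using (_⊎_; inj₁; inj₂)
  open import Function using (_∘_)
  open import Relation.Binary.PropositionalEquality
  open import Relation.Nullary using (¬_)
  open import Relation.Nullary.Decidable using (yes; no; Dec; map′)

  iter : ∀ {A : Set} → (A → A) → ℕ → A → A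
  iter f zero    u = u
  iter f (suc i) u = f (iter f i u)

  iter-+ : ∀ {A : Set} (f : A → A) i j u → iter f (i + j) u ≡ iter f i (iter f j u)
  iter-+ f zero    j u = refl
  iter-+ f (suc i) j u = cong f (iter-+ f i j u)

  iter-* : ∀ {A : Set} (f : A → A) m {u} → iter f m u ≡ u → ∀ k → iter f (k * m) u ≡ u
  iter-* f m e zero    = refl
  iter-* f m e (suc k) = trans (iter-+ f m (k * m) _) (trans (cong (iter f m) (iter-* f m e k)) e)

  record Reach {A : Set} (f : A → A) (u w : A) : Set where
    constructor _,_
    field
      steps   : ℕ
      arrives : iter f steps u ≡ w

  reach-refl : ∀ {A : Set} {f : A → A} {u} → Reach f u u
  reach-refl = 0 , refl

  reach-trans : ∀ {A : Set} {f : A → A} {u v w} → Reach f u v → Reach f v w → Reach f u w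
  reach-trans {f = f} {u} (i , refl) (j , refl) = j + i , iter-+ f j i u

  reach-⊆ : ∀ {A : Set} {f g : A → A} → (∀ u → Reach g u (f u)) → ∀ {u w} → Reach f u w → Reach g u w
  reach-⊆ h (zero  , refl) = reach-refl
  reach-⊆ h (suc i , refl) = reach-trans (reach-⊆ h (i , refl)) (h _)

  Injective : ∀ {A : Set} → (A → A) → Set
  Injective f = ∀ {u w} → f u ≡ f w → u ≡ w

  iter-injective : ∀ {A : Set} {f : A → A} → Injective f → ∀ i → Injective (iter f i)
  iter-injective inj zero    e = e
  iter-injective inj (suc i) e = iter-injective inj i (inj e)

  module _ {n : ℕ} {f : Fin n → Fin n} (inj : Injective f) where

    difference-period : ∀ {i j} u → i < j → iter f i u ≡ iter f j u → iter f (j ∸ i) u ≡ u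
    difference-period {i} {j} u i<j e = sym (iter-injective inj i (trans e (trans
      (cong (λ k → iter f k u) (sym (m+[n∸m]≡n (<⇒≤ i<j)))) (iter-+ f i (j ∸ i) u))))

    period : ∀ u → ∃ λ m → 1 ≤ m × m ≤ n × iter f m u ≡ u
    period u with pigeonhole (≤-refl {suc n}) (λ i → iter f (toℕ i) u)
    ... | i , j , i<j , e = toℕ j ∸ toℕ i , m<n⇒0<n∸m i<j ,
          ≤-trans (m∸n≤m (toℕ j) (toℕ i)) (s≤s⁻¹ (toℕ<n j)) , difference-period u i<j e

    reach-mod : ∀ m .{{_ : NonZero m}} {u} → iter f m u ≡ u → ∀ i → iter f (i % m) u ≡ iter f i u
    reach-mod m {u} e i = begin
      iter f (i % m) u                           ≡⟨ cong (iter f (i % m)) (iter-* f m e (i / m)) ⟨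
      iter f (i % m) (iter f (i / m * m) u)      ≡⟨ iter-+ f (i % m) _ u ⟨
      iter f (i % m + i / m * m) u               ≡⟨ cong (λ k → iter f k u) (m≡m%n+[m/n]*n i m) ⟨
      iter f i u                                 ∎
      where open ≡-Reasoning

    reach-sym : ∀ {u w} → Reach f u w → Reach f w u
    reach-sym {u} (i , refl) with period u
    -- i times the period leads from u back to u, and the first i of these steps lead to w.
    ... | suc m , _ , _ , e = i * suc m ∸ i , trans (sym (iter-+ f (i * suc m ∸ i) i u)) (trans
          (cong (λ k → iter f k u) (m∸n+n≡m (m≤m*n i (suc m)))) (iter-* f (suc m) e i))

    -- Numbers of steps can be reduced modulo the period, which is at most n; a bounded search
    -- decides.
    reach? : ∀ u w → Dec (Reach f u w)
    reach? u w with period u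
    ... | suc m , _ , m≤n , e = map′ (λ (i , p) → toℕ i , p) bounded (any? λ (i : Fin n) → iter f (toℕ i) u Fin.≟ w)
      where
      bounded : Reach f u w → ∃ λ (i : Fin n) → iter f (toℕ i) u ≡ w
      bounded (i , p) = fromℕ< i%m<n , trans (cong (λ k → iter f k u) (toℕ-fromℕ< i%m<n)) (trans (reach-mod (suc m) e i) p)
        where
        i%m<n : i % suc m < n
        i%m<n = <-≤-trans (m%n<n i (suc m)) m≤n

  module Exchange {n : ℕ} (f g : Fin n → Fin n) (f-inj : Injective f) (x y : Fin n) (x≁y : ¬ Reach f x y)
                  (gx : g x ≡ f y) (gy : g y ≡ f x) (g-else : ∀ u → u ≢ x → u ≢ y → g u ≡ f u) where

    private
      -- From x, `g` jumps to `f y` and then follows `f` around the cycle of y, which avoids x,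
      -- until that cycle closes at y.
      toward : ∀ {x y} → ¬ Reach f y x → g x ≡ f y → (∀ u → u ≢ x → u ≢ y → g u ≡ f u) → Reach g x y
      toward {x} {y} y≁x gx g-else with period f-inj y
      ... | suc m , _ , _ , e with walk m
        where
        walk : ∀ i → Reach g x y ⊎ Reach g x (iter f (suc i) y)
        walk zero = inj₂ (1 , gx)
        walk (suc i) with walk i
        ... | inj₁ r = inj₁ r
        ... | inj₂ r with iter f (suc i) y Fin.≟ y
        ...   | yes p = inj₁ (subst (Reach g x) p r)
        ...   | no p  = inj₂ (reach-trans r (1 , g-else _ (λ q → y≁x (suc i , q)) p))
      ... | inj₁ r = r
      ... | inj₂ r = subst (Reach g x) e r

    merged : Reach g x y
    merged = toward (x≁y ∘ reach-sym f-inj) gx g-else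

    private
      merged′ : Reach g y x
      merged′ = toward x≁y gy (λ u p q → g-else u q p)

    grows : ∀ {u w} → Reach f u w → Reach g u w
    grows = reach-⊆ λ u → step u
      where
      step : ∀ u → Reach g u (f u)
      step u with u Fin.≟ x | u Fin.≟ y
      ... | yes refl | _        = reach-trans merged (1 , gy)
      ... | no _     | yes refl = reach-trans merged′ (1 , gx)
      ... | no p     | no q     = 1 , g-else u p q

  transpose-left : ∀ {n} (i j : Fin n) → transpose i j ⟨$⟩ʳ i ≡ j
  transpose-left i j with i Fin.≟ i
  ... | yes _ = refl
  ... | no ¬p = ⊥-elim (¬p refl)

  transpose-right : ∀ {n} (i j : Fin n) → transpose i j ⟨$⟩ʳ j ≡ i
  transpose-right i j with j Fin.≟ i
  ... | yes p = p
  ... | no _ with j Fin.≟ j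
  ...   | yes _ = refl
  ...   | no ¬p = ⊥-elim (¬p refl)

  transpose-else : ∀ {n} (i j k : Fin n) → k ≢ i → k ≢ j → transpose i j ⟨$⟩ʳ k ≡ k
  transpose-else i j k p q with k Fin.≟ i
  ... | yes e = ⊥-elim (p e)
  ... | no _ with k Fin.≟ j
  ...   | yes e = ⊥-elim (q e)
  ...   | no _  = refl

  permutation-injective : ∀ {n} (π : Permutation′ n) → Injective (π ⟨$⟩ʳ_)
  permutation-injective π e = trans (sym (inverseˡ π)) (trans (cong (π ⟨$⟩ˡ_) e) (inverseˡ π))

  module Labelled {n : ℕ} {J : Set} (f : J → Fin n) (f-inj : ∀ {a b} → f a ≡ f b → a ≡ b)
                  (all : List J) (complete : ∀ a → a ∈ all) (out inn : J → ℕ) where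

    point? : ∀ u → Dec (∃ λ a → f a ≡ u)
    point? u = map′ (λ p → let (a , _ , e) = find p in a , e) (λ (a , e) → lose (complete a) e)
                    (Any.any? (λ a → f a Fin.≟ u) all)

    -- `inn b` stands for the class of the point b, `out a` for the class into which a is sent. Only
    -- classes are prescribed, so exchanging the images of two points with equal `out` preserves the
    -- condition.
    Respects : Permutation′ n → Set
    Respects τ = (∀ a → ∃ λ b → τ ⟨$⟩ʳ f a ≡ f b × inn b ≡ out a) × (∀ u → ¬ (∃ λ a → f a ≡ u) → τ ⟨$⟩ʳ u ≡ u)

    module _ (α α⁻ : J → J) (αα⁻ : ∀ a → α (α⁻ a) ≡ a) (α⁻α : ∀ a → α⁻ (α a) ≡ a) (label : ∀ a → inn (α a) ≡ out a) where

      private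
        along : (J → J) → Fin n → Fin n
        along α u with point? u
        ... | yes (a , _) = f (α a)
        ... | no _        = u

        along-point : ∀ α a → along α (f a) ≡ f (α a)
        along-point α a with point? (f a)
        ... | yes (b , e) = cong (f ∘ α) (f-inj e)
        ... | no ¬p       = ⊥-elim (¬p (a , refl))

        along-else : ∀ α u → ¬ (∃ λ a → f a ≡ u) → along α u ≡ u
        along-else α u ¬p with point? u
        ... | yes p = ⊥-elim (¬p p)
        ... | no _  = refl

        along-inverse : ∀ α β → (∀ a → α (β a) ≡ a) → ∀ u → along α (along β u) ≡ u
        along-inverse α β αβ u with point? u
        ... | yes (a , refl) = trans (along-point α (β a)) (cong f (αβ a))
        ... | no ¬p          = along-else α u ¬p

      extension : Σ (Permutation′ n) Respects
      extension = permutation (along α) (along α⁻) (along-inverse α α⁻ αα⁻) (along-inverse α⁻ α α⁻α) ,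
                  (λ a → α a , along-point α a , label a) , along-else α

    module _ (s : Fin n → Fin n) (s-inj : Injective s) where

      turn : Permutation′ n → Fin n → Fin n
      turn τ u = s (τ ⟨$⟩ʳ u)

      turn-injective : ∀ τ → Injective (turn τ)
      turn-injective τ e = permutation-injective τ (s-inj e)

      -- An exchange is made only between different cycles, so it merges and never splits. Pairs
      -- once connected stay connected, and a single pass through the list is enough.
      saturate : ∀ (ps : List (J × J)) τ → Respects τ → ∃ λ τ′ → Respects τ′ ×
                 (∀ {u w} → Reach (turn τ) u w → Reach (turn τ′) u w) ×
                 (∀ {a b} → (a , b) ∈ ps → out a ≡ out b → Reach (turn τ′) (f a) (f b))
      saturate [] τ R = τ , R , (λ r → r) , λ ()
      saturate ((a , b) ∷ ps) τ R with saturate ps τ R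
      ... | τ′ , R′@(moves , fixes) , grow , done with reach? (turn-injective τ′) (f a) (f b) | out a ≟ out b
      ...   | yes r  | _    = τ′ , R′ , grow , λ { (here refl) _ → r ; (there p) → done p }
      ...   | no _   | no q = τ′ , R′ , grow , λ { (here refl) e → ⊥-elim (q e) ; (there p) → done p }
      ...   | no ¬r  | yes ab = τ″ , (moves″ , fixes″) , (λ r → E.grows (grow r)) ,
              λ { (here refl) _ → E.merged ; (there p) e → E.grows (done p e) }
        where
        τ″ = transpose (f a) (f b) ∘ₚ τ′
        at-else : ∀ u → u ≢ f a → u ≢ f b → τ″ ⟨$⟩ʳ u ≡ τ′ ⟨$⟩ʳ u
        at-else u p q = cong (τ′ ⟨$⟩ʳ_) (transpose-else (f a) (f b) u p q)
        at-a : τ″ ⟨$⟩ʳ f a ≡ τ′ ⟨$⟩ʳ f b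
        at-a = cong (τ′ ⟨$⟩ʳ_) (transpose-left (f a) (f b))
        at-b : τ″ ⟨$⟩ʳ f b ≡ τ′ ⟨$⟩ʳ f a
        at-b = cong (τ′ ⟨$⟩ʳ_) (transpose-right (f a) (f b))
        module E = Exchange (turn τ′) (turn τ″) (turn-injective τ′) (f a) (f b) ¬r (cong s at-a) (cong s at-b) (λ u p q → cong s (at-else u p q))
        moves″-by : ∀ c → Dec (f c ≡ f a) → Dec (f c ≡ f b) → ∃ λ d → τ″ ⟨$⟩ʳ f c ≡ f d × inn d ≡ out c
        moves″-by c (yes p) _ = let (d , e , l) = moves b in
          d , trans (cong (τ″ ⟨$⟩ʳ_) p) (trans at-a e) , trans l (trans (sym ab) (cong out (sym (f-inj p))))
        moves″-by c (no _) (yes q) = let (d , e , l) = moves a in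
          d , trans (cong (τ″ ⟨$⟩ʳ_) q) (trans at-b e) , trans l (trans ab (cong out (sym (f-inj q))))
        moves″-by c (no p) (no q) = let (d , e , l) = moves c in d , trans (at-else (f c) p q) e , l
        moves″ : ∀ c → ∃ λ d → τ″ ⟨$⟩ʳ f c ≡ f d × inn d ≡ out c
        moves″ c = moves″-by c (f c Fin.≟ f a) (f c Fin.≟ f b)
        fixes″ : ∀ u → ¬ (∃ λ a → f a ≡ u) → τ″ ⟨$⟩ʳ u ≡ u
        fixes″ u ¬p = trans (at-else u (λ e → ¬p (a , sym e)) (λ e → ¬p (b , sym e))) (fixes u ¬p)

      saturated : ∀ τ → Respects τ → ∃ λ τ′ → Respects τ′ × (∀ a b → out a ≡ out b → Reach (turn τ′) (f a) (f b))
      saturated τ R with saturate (cartesianProduct all all) τ R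
      ... | τ′ , R′ , _ , done = τ′ , R′ , λ a b → done (∈-cartesianProduct⁺ (complete a) (complete b))

      module _ (τ : Permutation′ n) (R : Respects τ) where

        -- A preimage outside the points would be fixed by `τ` and hence be the point `f b` itself.
        preimage : ∀ b → ∃ λ a → τ ⟨$⟩ʳ f a ≡ f b × inn b ≡ out a
        preimage b with point? (τ ⟨$⟩ˡ f b)
        ... | no ¬p = ⊥-elim (¬p (b , trans (sym (inverseʳ τ)) (proj₂ R _ ¬p)))
        ... | yes (a , e) with proj₁ R a
        ...   | c , e′ , l with f-inj {c} {b} (trans (sym e′) (trans (cong (τ ⟨$⟩ʳ_) e) (inverseʳ τ)))
        ...     | refl = a , e′ , l

        -- The walk enters just behind `f b` and from there follows `s` for as long as it meets no
        -- point, since `τ` fixes all other vertices.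
        reach-along : ∀ {a b} → τ ⟨$⟩ʳ f a ≡ f b → ∀ d →
                      (∀ i → i < d → ¬ (∃ λ c → f c ≡ iter s (suc i) (f b))) →
                      Reach (turn τ) (f a) (iter s (suc d) (f b))
        reach-along e zero    free = 1 , cong s e
        reach-along e (suc d) free = reach-trans (reach-along e d (λ i i<d → free i (m≤n⇒m≤1+n i<d)))
                                                 (1 , cong s (proj₂ R _ (free d ≤-refl)))

        -- Away from the points `turn τ` is `s`; the vertex just behind a point is entered from the
        -- `τ`-preimage of that point. So each vertex on the `s`-orbit is traced back to some point.
        reach-from-point : ∀ b i → ∃ λ a → Reach (turn τ) (f a) (iter s i (f b))
        reach-from-point b zero = b , reach-refl
        reach-from-point b (suc i) with point? (iter s i (f b))
        ... | no ¬p = let (a , r) = reach-from-point b i in a , reach-trans r (1 , cong s (proj₂ R _ ¬p))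
        ... | yes (c , e) = let (a , e′ , _) = preimage c in a , 1 , cong s (trans e′ e)

-- The successor map of the cyclic order as a transitive permutation.

module Cyclic where

  open import Data.Empty using (⊥-elim)
  open import Data.Fin using (Fin; zero; suc; toℕ; fromℕ; inject₁)
  open import Data.Fin.Permutation using (Permutation′; permutation)
  open import Data.Fin.Properties using (toℕ-fromℕ<; toℕ<n; toℕ-injective; toℕ-fromℕ; toℕ-inject₁)
  open import Data.Nat
  open import Data.Nat.Properties
  open import Data.Product using (_,_)
  open import Data.Sum using (inj₁; inj₂)
  open import Relation.Binary.PropositionalEquality
  open import Relation.Nullary.Decidable using (yes; no)
  open import Defs using (next)
  open Orbits

  next-suc : ∀ {n} (k : Fin n) → suc (toℕ k) < n → toℕ (next k) ≡ suc (toℕ k)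
  next-suc {suc n} k lt with suc (toℕ k) <? suc n
  ... | yes p = toℕ-fromℕ< p
  ... | no ¬p = ⊥-elim (¬p lt)

  next-last : ∀ {n} (k : Fin n) → suc (toℕ k) ≡ n → toℕ (next k) ≡ 0
  next-last {suc n} k e with suc (toℕ k) <? suc n
  ... | yes p = ⊥-elim (<⇒≢ p e)
  ... | no _  = refl

  prev : ∀ {n} → Fin n → Fin n
  prev {suc n} zero    = fromℕ n
  prev {suc n} (suc k) = inject₁ k

  next-prev : ∀ {n} (k : Fin n) → next (prev k) ≡ k
  next-prev {suc n} zero    = toℕ-injective (next-last (fromℕ n) (cong suc (toℕ-fromℕ n)))
  next-prev {suc n} (suc k) = toℕ-injective (trans
    (next-suc (inject₁ k) (s≤s (subst (_< n) (sym (toℕ-inject₁ k)) (toℕ<n k)))) (cong suc (toℕ-inject₁ k)))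

  prev-toℕ : ∀ {n} (k : Fin n) i → toℕ k ≡ suc i → toℕ (prev k) ≡ i
  prev-toℕ (suc k) i e = trans (toℕ-inject₁ k) (suc-injective e)

  prev-next : ∀ {n} (k : Fin n) → prev (next k) ≡ k
  prev-next {suc n} k with m≤n⇒m<n∨m≡n (toℕ<n k)
  ... | inj₁ lt = toℕ-injective (prev-toℕ (next k) (toℕ k) (next-suc k lt))
  ... | inj₂ e with next k | next-last k e
  ...   | zero | _ = toℕ-injective (trans (toℕ-fromℕ n) (sym (suc-injective e)))

  nextₚ : ∀ {n} → Permutation′ n
  nextₚ = permutation next prev next-prev prev-next

  next-injective : ∀ {n} → Injective (next {n})
  next-injective = permutation-injective nextₚ

  iter-next : ∀ {n} (k : Fin n) i → toℕ k + i < n → toℕ (iter next i k) ≡ toℕ k + i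
  iter-next k zero    lt = sym (+-identityʳ _)
  iter-next {n} k (suc i) lt = trans (next-suc (iter next i k) (subst (_< n) (sym e) lt)) e
    where
    e : suc (toℕ (iter next i k)) ≡ toℕ k + suc i
    e = trans (cong suc (iter-next k i (≤-<-trans (+-monoʳ-≤ (toℕ k) (n≤1+n i)) lt))) (sym (+-suc (toℕ k) i))

  next-transitive : ∀ {n} (j k : Fin n) → Reach next j k
  next-transitive {suc n} j k = reach-trans (reach-sym next-injective (from-zero j)) (from-zero k)
    where
    from-zero : ∀ k → Reach next zero k
    from-zero k = toℕ k , toℕ-injective (iter-next zero (toℕ k) (toℕ<n k))

-- The permutation that repairs the edge behind `v` and keeps a single cycle.

module Rotation where

  open import Data.Bool using (true)
  open import Data.Empty using (⊥; ⊥-elim)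
  open import Data.Fin using (Fin; zero; suc; toℕ; fromℕ<)
  open import Data.Fin.Permutation using (Permutation′; _⟨$⟩ʳ_)
  open import Data.Fin.Properties using (toℕ-fromℕ<; toℕ<n; toℕ-injective)
  open import Data.List using (List; []; _∷_; _++_; map; allFin)
  open import Data.List.Membership.Propositional using (_∈_)
  open import Data.List.Membership.Propositional.Properties using (∈-++⁺ˡ; ∈-++⁺ʳ; ∈-map⁺; ∈-allFin)
  open import Data.List.Relation.Unary.Any using (here)
  open import Data.Nat
  open import Data.Nat.DivMod using (/-monoˡ-≤)
  open import Data.Nat.Properties
  open import Data.Product using (∃; _×_; _,_; proj₁; proj₂)
  open import Data.Sum using (_⊎_; inj₁; inj₂)
  open import Relation.Binary.PropositionalEquality
  open import Relation.Nullary using (¬_)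
  open import Relation.Nullary.Decidable using (yes; no)
  open Counting using (Rel)
  open Chains
  open Selection using (block)
  open Orbits
  open Cyclic
  open import Defs using (next)

  -- Rows x and y rotate through all classes, row z through v and the first m + 1 classes.
  data Point (k m : ℕ) : Set where
    X Y : Fin (suc k) → Point k m
    Z   : Fin (suc (suc m)) → Point k m

  module _ {n : ℕ} (L : ℕ) .{{_ : NonZero L}} (H : Rel n) (v : Fin n) (k m : ℕ) (m<k : m < k)
           (c : Chain L H (block L v ∷ []) k) where
    open Chain c

    module _ (v-T₀ : ∀ {u} → u ∈ₜ T 0 → H v u ≡ true) (Tₘ-v : ∀ {u} → u ∈ₜ T m → H u v ≡ true)
             (Tₖ-T₀ : ∀ {u w} → u ∈ₜ T k → w ∈ₜ T 0 → H u w ≡ true) where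

      private
        P = Point k m

        f : P → Fin n
        f (X j)       = x (T (toℕ j))
        f (Y j)       = y (T (toℕ j))
        f (Z zero)    = v
        f (Z (suc i)) = z (T (toℕ i))

        out inn : P → ℕ
        out (X j) = toℕ (next j)
        out (Y j) = toℕ (next j)
        -- Place 0 of row z is `v`, which is sent to class 0; place i + 1 is class i, sent to class
        -- i + 1.
        out (Z i) = toℕ i
        inn (X j)       = toℕ j
        inn (Y j)       = toℕ j
        -- `v` poses as a member of class m + 1. The points sent to this class are those of `T m`,
        -- all of which are joined both to `T (suc m)` and to `v`, so exchanges among them are
        -- harmless.
        inn (Z zero)    = suc m
        inn (Z (suc i)) = toℕ i

        α α⁻ : P → P
        α (X j) = X (next j)
        α (Y j) = Y (next j)
        α (Z i) = Z (next i)
        α⁻ (X j) = X (prev j)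
        α⁻ (Y j) = Y (prev j)
        α⁻ (Z i) = Z (prev i)

        αα⁻ : ∀ a → α (α⁻ a) ≡ a
        αα⁻ (X j) = cong X (next-prev j)
        αα⁻ (Y j) = cong Y (next-prev j)
        αα⁻ (Z i) = cong Z (next-prev i)

        α⁻α : ∀ a → α⁻ (α a) ≡ a
        α⁻α (X j) = cong X (prev-next j)
        α⁻α (Y j) = cong Y (prev-next j)
        α⁻α (Z i) = cong Z (prev-next i)

        inn-Z : ∀ i j → toℕ i ≡ suc j → inn (Z i) ≡ j
        inn-Z (suc i) j e = suc-injective e

        label : ∀ a → inn (α a) ≡ out a
        label (X j) = refl
        label (Y j) = refl
        label (Z i) with m≤n⇒m<n∨m≡n (toℕ<n i)
        ... | inj₁ lt = inn-Z (next i) (toℕ i) (next-suc i lt)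
        ... | inj₂ e with next i | next-last i e
        ...   | zero | _ = sym (suc-injective e)

        ≤k : (j : Fin (suc k)) → toℕ j ≤ k
        ≤k j = s≤s⁻¹ (toℕ<n j)

        ≤k′ : (i : Fin (suc m)) → toℕ i ≤ k
        ≤k′ i = ≤-trans (s≤s⁻¹ (toℕ<n i)) (<⇒≤ m<k)

        data View (a : P) : Set where
          extra : inn a ≡ suc m → f a ≡ v → View a
          class : inn a ≤ k → f a ∈ₜ T (inn a) → View a

        view : ∀ a → View a
        view (X j)       = class (≤k j) is-x
        view (Y j)       = class (≤k j) is-y
        view (Z zero)    = extra refl refl
        view (Z (suc i)) = class (≤k′ i) is-z

        same-class : ∀ {i j u w} → i ≤ k → j ≤ k → u ∈ₜ T i → w ∈ₜ T j → u ≡ w → i ≡ j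
        same-class {i} {j} i≤ j≤ u∈ w∈ refl = distinct i j i≤ j≤ (trans (sym (in-block i i≤ u∈)) (in-block j j≤ w∈))

        v∉ : ∀ {j u} → j ≤ k → u ∈ₜ T j → u ≢ v
        v∉ {j} j≤ u∈ refl = fresh j j≤ (here (sym (in-block j j≤ u∈)))

        x≢y : ∀ {i j} → i ≤ k → i ≡ j → x (T i) ≢ y (T j)
        x≢y {i} i≤ refl e = <⇒≢ (proj₁ (ascending i i≤)) (cong toℕ e)

        y≢z : ∀ {i j} → i ≤ k → i ≡ j → y (T i) ≢ z (T j)
        y≢z {i} i≤ refl e = <⇒≢ (proj₂ (ascending i i≤)) (cong toℕ e)

        x≢z : ∀ {i j} → i ≤ k → i ≡ j → x (T i) ≢ z (T j)
        x≢z {i} i≤ refl e = <⇒≢ (<-trans (proj₁ (ascending i i≤)) (proj₂ (ascending i i≤))) (cong toℕ e)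

        f-inj : ∀ {a b} → f a ≡ f b → a ≡ b
        f-inj {X i} {X j} e = cong X (toℕ-injective (same-class (≤k i) (≤k j) is-x is-x e))
        f-inj {X i} {Y j} e = ⊥-elim (x≢y (≤k i) (same-class (≤k i) (≤k j) is-x is-y e) e)
        f-inj {Y i} {X j} e = ⊥-elim (x≢y (≤k j) (same-class (≤k j) (≤k i) is-x is-y (sym e)) (sym e))
        f-inj {Y i} {Y j} e = cong Y (toℕ-injective (same-class (≤k i) (≤k j) is-y is-y e))
        f-inj {X i} {Z zero} e = ⊥-elim (v∉ (≤k i) is-x e)
        f-inj {Y i} {Z zero} e = ⊥-elim (v∉ (≤k i) is-y e)
        f-inj {Z zero} {X j} e = ⊥-elim (v∉ (≤k j) is-x (sym e))
        f-inj {Z zero} {Y j} e = ⊥-elim (v∉ (≤k j) is-y (sym e))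
        f-inj {X i} {Z (suc j)} e = ⊥-elim (x≢z (≤k i) (same-class (≤k i) (≤k′ j) is-x is-z e) e)
        f-inj {Y i} {Z (suc j)} e = ⊥-elim (y≢z (≤k i) (same-class (≤k i) (≤k′ j) is-y is-z e) e)
        f-inj {Z (suc i)} {X j} e = ⊥-elim (x≢z (≤k j) (same-class (≤k j) (≤k′ i) is-x is-z (sym e)) (sym e))
        f-inj {Z (suc i)} {Y j} e = ⊥-elim (y≢z (≤k j) (same-class (≤k j) (≤k′ i) is-y is-z (sym e)) (sym e))
        f-inj {Z zero}    {Z zero}    e = refl
        f-inj {Z zero}    {Z (suc j)} e = ⊥-elim (v∉ (≤k′ j) is-z (sym e))
        f-inj {Z (suc i)} {Z zero}    e = ⊥-elim (v∉ (≤k′ i) is-z e)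
        f-inj {Z (suc i)} {Z (suc j)} e = cong (λ j → Z (suc j)) (toℕ-injective (same-class (≤k′ i) (≤k′ j) is-z is-z e))

        step-H : ∀ {i o u} b → i ≤ k → u ∈ₜ T i → (suc i ≤ k × o ≡ suc i) ⊎ (i ≡ k × o ≡ 0) → inn b ≡ o → H u (f b) ≡ true
        step-H {i} {o} b i≤ u∈ (inj₁ (lt , refl)) e with view b
        ... | extra e′ fb = trans (cong (H _) fb) (Tₘ-v (subst (λ i → _ ∈ₜ T i) (suc-injective (trans (sym e) e′)) u∈))
        ... | class _ b∈    = joined i lt u∈ (subst (λ i → f b ∈ₜ T i) e b∈)
        step-H b i≤ u∈ (inj₂ (refl , refl)) e with view b
        ... | extra e′ _ with () ← trans (sym e) e′
        ... | class _ b∈ = Tₖ-T₀ u∈ (subst (λ i → f b ∈ₜ T i) e b∈)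

        next-cases : (j : Fin (suc k)) → (suc (toℕ j) ≤ k × toℕ (next j) ≡ suc (toℕ j)) ⊎ (toℕ j ≡ k × toℕ (next j) ≡ 0)
        next-cases j with m≤n⇒m<n∨m≡n (toℕ<n j)
        ... | inj₁ lt = inj₁ (s≤s⁻¹ lt , next-suc j lt)
        ... | inj₂ e  = inj₂ (suc-injective e , next-last j e)

        compatible : ∀ a b → inn b ≡ out a → H (f a) (f b) ≡ true
        compatible (X j) b e = step-H b (≤k j) is-x (next-cases j) e
        compatible (Y j) b e = step-H b (≤k j) is-y (next-cases j) e
        compatible (Z (suc i)) b e = step-H b (≤k′ i) is-z (inj₁ (≤-trans (toℕ<n i) m<k , refl)) e
        compatible (Z zero) b e with view b
        ... | extra e′ _ with () ← trans (sym e) e′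
        ... | class _ b∈ = v-T₀ (subst (λ i → f b ∈ₜ T i) e b∈)

        points : List P
        points = map X (allFin _) ++ map Y (allFin _) ++ map Z (allFin _)

        complete : ∀ a → a ∈ points
        complete (X j) = ∈-++⁺ˡ (∈-map⁺ X (∈-allFin j))
        complete (Y j) = ∈-++⁺ʳ (map X (allFin _)) (∈-++⁺ˡ (∈-map⁺ Y (∈-allFin j)))
        complete (Z i) = ∈-++⁺ʳ (map X (allFin _)) (∈-++⁺ʳ (map Y (allFin _)) (∈-map⁺ Z (∈-allFin i)))

        open Labelled f f-inj points complete out inn

        -- Blocks are intervals, so a point strictly between x and y lies in their block. This
        -- excludes `v` and all other classes, and within the class z comes after y.
        between : ∀ {i} → i ≤ k → ∀ a → toℕ (x (T i)) < toℕ (f a) → toℕ (f a) < toℕ (y (T i)) → ⊥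
        between {i} i≤ a x<a a<y = excluded (view a)
          where
          block≡ : block L (f a) ≡ β i
          block≡ = ≤-antisym
            (subst (block L (f a) ≤_) (in-block i i≤ is-y) (/-monoˡ-≤ L (<⇒≤ a<y)))
            (subst (_≤ block L (f a)) (in-block i i≤ is-x) (/-monoˡ-≤ L (<⇒≤ x<a)))
          outside : ∀ {u} → u ∈ₜ T i → toℕ (x (T i)) < toℕ u → toℕ u < toℕ (y (T i)) → ⊥
          outside is-x p _ = <-irrefl refl p
          outside is-y _ q = <-irrefl refl q
          outside is-z _ q = <-asym q (proj₂ (ascending i i≤))
          excluded : View a → ⊥
          excluded (extra _ e) = fresh i i≤ (here (trans (sym block≡) (cong (block L) e)))
          excluded (class a≤ a∈) with distinct (inn a) i a≤ i≤ (trans (sym (in-block (inn a) a≤ a∈)) block≡)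
          ... | refl = outside a∈ x<a a<y

        module _ (τ : Permutation′ n) (R : Respects τ) (merged : ∀ a b → out a ≡ out b → Reach (turn next next-injective τ) (f a) (f b)) where
          ρ : Fin n → Fin n
          ρ = turn next next-injective τ

          _∼_ : Fin n → Fin n → Set
          u ∼ w = Reach ρ u w

          ∼-sym : ∀ {u w} → u ∼ w → w ∼ u
          ∼-sym = reach-sym (turn-injective next next-injective τ)

          -- The ρ-walk from the τ-preimage of an x-vertex passes through the y-vertex of the same class.
          advance : ∀ j → f (Y j) ∼ f (Y (next j))
          advance j with preimage next next-injective τ R (X (next j))
          ... | a , e , l = reach-trans (merged (Y j) a l) (subst (λ w → f a ∼ w) arrive
                              (reach-along next next-injective τ R {a} {X (next j)} e d free))
            where
            i = toℕ (next j)
            i≤ = ≤k (next j)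
            xᵢ = x (T i)
            yᵢ = y (T i)
            x<y : toℕ xᵢ < toℕ yᵢ
            x<y = proj₁ (ascending i i≤)
            d = toℕ yᵢ ∸ suc (toℕ xᵢ)
            x+d : toℕ xᵢ + suc d ≡ toℕ yᵢ
            x+d = trans (+-suc (toℕ xᵢ) d) (m+[n∸m]≡n x<y)
            arrive : iter next (suc d) xᵢ ≡ yᵢ
            arrive = toℕ-injective (trans (iter-next xᵢ (suc d) (subst (_< n) (sym x+d) (toℕ<n yᵢ))) x+d)
            free : ∀ t → t < d → ¬ (∃ λ b → f b ≡ iter next (suc t) xᵢ)
            free t t<d (b , e′) = between i≤ b
              (subst (toℕ xᵢ <_) (sym at) (m<m+n (toℕ xᵢ) (s≤s z≤n)))
              (subst (_< toℕ yᵢ) (sym at) below)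
              where
              below : toℕ xᵢ + suc t < toℕ yᵢ
              below = subst (toℕ xᵢ + suc t <_) x+d (+-monoʳ-< (toℕ xᵢ) (s≤s t<d))
              at : toℕ (f b) ≡ toℕ xᵢ + suc t
              at = trans (cong toℕ e′) (iter-next xᵢ (suc t) (<-trans below (toℕ<n yᵢ)))

          hub : Fin n
          hub = f (Y zero)

          hub-iter : ∀ i → hub ∼ f (Y (iter next i zero))
          hub-iter zero    = reach-refl
          hub-iter (suc i) = reach-trans (hub-iter i) (advance (iter next i zero))

          hub-Y : ∀ j → hub ∼ f (Y j)
          hub-Y j = let (i , e) = next-transitive zero j in subst (λ j → hub ∼ f (Y j)) e (hub-iter i)

          -- The y-vertices together take every value of `out`, so saturation puts each point on the
          -- cycle of one of them.
          hub-point : ∀ a → hub ∼ f a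
          hub-point a@(X j) = reach-trans (hub-Y j) (merged (Y j) a refl)
          hub-point a@(Y j) = hub-Y j
          hub-point a@(Z i) = reach-trans (hub-Y (prev l)) (merged (Y (prev l)) a
              (trans (cong toℕ (next-prev l)) (toℕ-fromℕ< _)))
            where
            l : Fin (suc k)
            l = fromℕ< (≤-trans (toℕ<n i) (s≤s m<k))

          hub-all : ∀ u → hub ∼ u
          hub-all u = let (i , e) = next-transitive v u
                          (a , r) = reach-from-point next next-injective τ R (Z zero) i
                      in subst (hub ∼_) e (reach-trans (hub-point a) r)

          transitive : ∀ u w → u ∼ w
          transitive u w = reach-trans (∼-sym (hub-all u)) (hub-all w)

        module _ (τ : Permutation′ n) (R : Respects τ) where
          good : ∀ a → H (f a) (τ ⟨$⟩ʳ f a) ≡ true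
          good a = let (b , e , l) = proj₁ R a in trans (cong (H (f a)) e) (compatible a b l)

          fixed-or-good : ∀ u → τ ⟨$⟩ʳ u ≡ u ⊎ H u (τ ⟨$⟩ʳ u) ≡ true
          fixed-or-good u with point? u
          ... | no ¬p          = inj₁ (proj₂ R u ¬p)
          ... | yes (a , refl) = inj₂ (good a)

      rotation : ∃ λ (τ : Permutation′ n) → (∀ u → τ ⟨$⟩ʳ u ≡ u ⊎ H u (τ ⟨$⟩ʳ u) ≡ true) × H v (τ ⟨$⟩ʳ v) ≡ true ×
                 (∀ u w → Reach (λ u → next (τ ⟨$⟩ʳ u)) u w)
      rotation =
        let (τ₀ , R₀)         = extension α α⁻ αα⁻ α⁻α label
            (τ , R , merged)  = saturated next next-injective τ₀ R₀
        in τ , fixed-or-good τ R , good τ R (Z zero) , transitive τ R merged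

-- Induction on the number of missing edges.

module Descent where

  open import Data.Bool using (true; false; not)
  open import Data.Empty using (⊥-elim)
  open import Data.Fin using (Fin; zero; suc; toℕ; fromℕ<)
  open import Data.Fin.Permutation using (Permutation′; _⟨$⟩ʳ_; permutation; _∘ₚ_; id)
  open import Data.Fin.Properties using (toℕ-fromℕ<; toℕ<n; toℕ-injective; injective⇒≤)
  open import Data.Nat
  open import Data.Nat.DivMod using (m%n<n)
  open import Data.Nat.Induction using (<-wellFounded)
  open import Data.Nat.Properties
  open import Data.Product using (∃; _,_)
  open import Data.Sum using (_⊎_; inj₁; inj₂)
  open import Induction.WellFounded using (Acc; acc)
  open import Relation.Binary.PropositionalEquality
  open import Relation.Binary.Definitions using (tri<; tri≈; tri>)
  open import Relation.Nullary.Decidable using (⌊_⌋)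
  open Counting
  open Expansion
  open Chains
  open Orbits
  open Cyclic
  open Rotation
  open import Defs using (Digraph; next; HamiltonCycle)

  module _ {n : ℕ} {f : Fin n → Fin n} (f-inj : Injective f) (v : Fin n) (all : ∀ u → Reach f v u) where

    private
      -- If the orbit of `v` closed after d steps, numbers of steps modulo d would still distinguish
      -- all n vertices.
      period≥n : ∀ d → 1 ≤ d → iter f d v ≡ v → n ≤ d
      period≥n d@(suc _) _ e = injective⇒≤ {f = index} λ {u} {w} eq →
          trans (sym (at u)) (trans (cong (λ i → iter f (toℕ i) v) eq) (at w))
        where
        index : Fin n → Fin d
        index u = fromℕ< (m%n<n (Reach.steps (all u)) d)
        at : ∀ u → iter f (toℕ (index u)) v ≡ u
        at u = trans (cong (λ i → iter f i v) (toℕ-fromℕ< (m%n<n (Reach.steps (all u)) d)))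
                     (trans (reach-mod f-inj d e (Reach.steps (all u))) (Reach.arrives (all u)))

      returns : iter f n v ≡ v
      returns = let (m , 1≤m , m≤n , e) = period f-inj v in
        subst (λ m → iter f m v ≡ v) (≤-antisym m≤n (period≥n m 1≤m e)) e

      instance
        n≢0 : NonZero n
        n≢0 = >-nonZero (≤-trans (s≤s z≤n) (toℕ<n v))

      φ : Fin n → Fin n
      φ k = iter f (toℕ k) v

      ψ : Fin n → Fin n
      ψ u = fromℕ< (m%n<n (Reach.steps (all u)) n)

      φψ : ∀ u → φ (ψ u) ≡ u
      φψ u = trans (cong (λ i → iter f i v) (toℕ-fromℕ< (m%n<n (Reach.steps (all u)) n)))
                   (trans (reach-mod f-inj n returns (Reach.steps (all u))) (Reach.arrives (all u)))

      no-repeat : ∀ {i j} → i < j → j < n → iter f i v ≢ iter f j v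
      no-repeat {i} {j} i<j j<n e = <⇒≱ (≤-<-trans (m∸n≤m j i) j<n)
        (period≥n (j ∸ i) (m<n⇒0<n∸m i<j) (difference-period f-inj v i<j e))

      φ-injective : ∀ {i j} → φ i ≡ φ j → i ≡ j
      φ-injective {i} {j} e with <-cmp (toℕ i) (toℕ j)
      ... | tri< lt _ _ = ⊥-elim (no-repeat lt (toℕ<n j) e)
      ... | tri≈ _ eq _ = toℕ-injective eq
      ... | tri> _ _ gt = ⊥-elim (no-repeat gt (toℕ<n i) (sym e))

      φ-next : ∀ k → φ (next k) ≡ f (φ k)
      φ-next k with m≤n⇒m<n∨m≡n (toℕ<n k)
      ... | inj₁ lt = cong (λ i → iter f i v) (next-suc k lt)
      ... | inj₂ e  = trans (cong (λ i → iter f i v) (next-last k e)) (trans (sym returns) (cong (λ i → iter f i v) (sym e)))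

    cyclic-order : ∃ λ (σ : Permutation′ n) → ∀ k → σ ⟨$⟩ʳ next k ≡ f (σ ⟨$⟩ʳ k)
    cyclic-order = permutation φ ψ φψ (λ k → φ-injective (φψ (φ k))) , φ-next

  module _ {n : ℕ} (e : ℕ) where

    half-relabel : ∀ (R : Rel n) (p q : Permutation′ n) → Half e R → Half e (λ x y → R (p ⟨$⟩ʳ x) (q ⟨$⟩ʳ y))
    half-relabel R p q h i 1≤i 2i<n with h i 1≤i 2i<n
    ... | inj₁ many = inj₁ (subst (λ m → n < m + i) (sym (trans
            (♯-cong (λ x → cong (λ d → ⌊ i + 8 * e ≤? d ⌋) (♯-permute (R (p ⟨$⟩ʳ x)) q)))
            (♯-permute (λ x → ⌊ i + 8 * e ≤? ♯ (R x) ⌋) p))) many)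
    ... | inj₂ many = inj₂ (subst (i + 8 * e ≤_) (sym (trans
            (♯-cong (λ y → cong (λ d → ⌊ n ≤? d + i ⌋) (♯-permute ((R ᵀ) (q ⟨$⟩ʳ y)) p)))
            (♯-permute (λ y → ⌊ n ≤? ♯ ((R ᵀ) y) + i ⌋) q))) many)

    relabel : ∀ (R : Rel n) (p q : Permutation′ n) → DegreeCond e R → DegreeCond e (λ x y → R (p ⟨$⟩ʳ x) (q ⟨$⟩ʳ y))
    relabel R p q D = record
      { half-out = half-relabel R p q half-out
      ; half-in  = half-relabel (R ᵀ) q p half-in
      ; min-out  = λ x → subst (8 * e ≤_) (sym (♯-permute (R (p ⟨$⟩ʳ x)) q)) (min-out _)
      ; min-in   = λ y → subst (8 * e ≤_) (sym (♯-permute ((R ᵀ) (q ⟨$⟩ʳ y)) p)) (min-in _) }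
      where open DegreeCond D

  module _ {n : ℕ} (K e : ℕ) (G : Digraph n) (D : DegreeCond e (Digraph.E G))
           (1≤K : 1 ≤ K) (1≤e : 1 ≤ e) (8e≤n : 8 * e ≤ n) (n≤Ke : n ≤ K * e) (n₀≤n : Constants.n₀ K ≤ n) where
    open Digraph G
    open Constants K

    bad : Permutation′ n → Sub n
    bad π k = not (E (π ⟨$⟩ʳ k) (π ⟨$⟩ʳ next k))

    -- H x y says that x may take over the cyclic successor of y; the new order is next ∘ τ for a permutation τ along H.
    improve : ∀ π v → bad π v ≡ true → ∃ λ π′ → ♯ (bad π′) < ♯ (bad π)
    improve π v bad-v =
      let H : Rel n
          H x y                            = E (π ⟨$⟩ʳ x) (π ⟨$⟩ʳ next y)
          (c , v-T₀ , Tᵣ-v , Tₗ-T₀)        = closed-chain K e H (relabel e E π (nextₚ ∘ₚ π) D) 1≤K 1≤e 8e≤n n≤Ke n₀≤n v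
          (τ , fixed , good-v , all)       = rotation L H v (suc l) (suc r) (s≤s (s≤s (m≤m+n r r))) c v-T₀ Tᵣ-v Tₗ-T₀
          (σ , σ-next)                     = cyclic-order (λ eq → permutation-injective τ (next-injective eq)) v (all v)
      in σ ∘ₚ π , fewer τ fixed good-v σ σ-next
      where
      fewer : ∀ (τ : Permutation′ n) →
              (∀ u → τ ⟨$⟩ʳ u ≡ u ⊎ E (π ⟨$⟩ʳ u) (π ⟨$⟩ʳ next (τ ⟨$⟩ʳ u)) ≡ true) →
              E (π ⟨$⟩ʳ v) (π ⟨$⟩ʳ next (τ ⟨$⟩ʳ v)) ≡ true →
              ∀ (σ : Permutation′ n) → (∀ k → σ ⟨$⟩ʳ next k ≡ next (τ ⟨$⟩ʳ (σ ⟨$⟩ʳ k))) → ♯ (bad (σ ∘ₚ π)) < ♯ (bad π)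
      fewer τ fixed good-v σ σ-next = subst (_< ♯ (bad π)) (sym (trans
          (♯-cong (λ k → cong (λ u → not (E (π ⟨$⟩ʳ (σ ⟨$⟩ʳ k)) (π ⟨$⟩ʳ u))) (σ-next k)))
          (♯-permute after σ))) (♯-strict {A = after} {bad π} still v (cong not good-v) bad-v)
        where
        after : Sub n
        after u = not (E (π ⟨$⟩ʳ u) (π ⟨$⟩ʳ next (τ ⟨$⟩ʳ u)))
        -- A vertex fixed by `τ` keeps its old successor, and a moved one receives a successor along
        -- an edge; thus no new missing edge appears.
        still : ∀ u → after u ≡ true → bad π u ≡ true
        still u h with fixed u
        ... | inj₁ e = subst (λ w → not (E (π ⟨$⟩ʳ u) (π ⟨$⟩ʳ next w)) ≡ true) e h
        ... | inj₂ g with () ← trans (sym g) (not-true h)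

    hamiltonian : HamiltonCycle G
    hamiltonian = descend id (<-wellFounded (♯ (bad id)))
      where
      descend : ∀ π → Acc _<_ (♯ (bad π)) → HamiltonCycle G
      descend π (acc rs) with ♯ (bad π) in eq
      ... | zero  = π , λ k → good k (E (π ⟨$⟩ʳ k) (π ⟨$⟩ʳ next k)) refl
        where
        good : ∀ k b → E (π ⟨$⟩ʳ k) (π ⟨$⟩ʳ next k) ≡ b → E (π ⟨$⟩ʳ k) (π ⟨$⟩ʳ next k) ≡ true
        good k true  e = e
        good k false e with () ← subst (1 ≤_) eq (♯-member (bad π) k (cong not e))
      ... | suc m =
        let (v , bad-v)   = ♯-pos (bad π) (subst (1 ≤_) (sym eq) (s≤s z≤n))
            (π′ , fewer)  = improve π v bad-v
        in descend π′ (rs (subst (♯ (bad π′) <_) eq fewer))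

-- From sorted degree sequences to numbers of vertices.

module Sequences where

  open import Data.Bool using (true; false; not)
  open import Data.Empty using (⊥-elim)
  open import Data.Fin using (Fin; zero; suc)
  import Data.Fin as Fin
  open import Data.List using (_∷_; length; filter; map; allFin; tabulate)
  open import Data.List.Properties using (filter-all; length-map; length-tabulate; map-tabulate)
  open import Data.List.Relation.Binary.Permutation.Propositional.Properties using (↭-length; filter-↭)
  open import Data.List.Relation.Unary.All using (_∷_)
  import Data.List.Relation.Unary.All as All
  open import Data.List.Relation.Unary.AllPairs using (AllPairs; _∷_)
  open import Data.List.Relation.Unary.Linked.Properties using (Linked⇒AllPairs)
  open import Data.List.Sort.InsertionSort.Properties using (sort-↭; sort-↗)
  open import Data.Nat
  open import Data.Nat.Properties
  open import Data.Nat.Tactic.RingSolver using (solve-∀)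
  open import Data.Product using (Σ; _×_; _,_)
  open import Data.Sum using (_⊎_; inj₁; inj₂)
  open import Function using (_∘_)
  open import Relation.Binary.PropositionalEquality
  open import Relation.Nullary.Decidable using (⌊_⌋; yes; no; Dec; does; isYes≗does)
  open import Relation.Unary using (Decidable)
  open Counting
  open Expansion
  open Selection using (length-elements; ♯-subsingleton)
  open import Defs using (Digraph; outdeg; indeg; sortℕ; nth)

  private
    length-filter-∷ : ∀ w x xs → length (filter (w ≤?_) xs) ≤ length (filter (w ≤?_) (x ∷ xs))
    length-filter-∷ w x xs with w ≤ᵇ x
    ... | true  = n≤1+n _
    ... | false = ≤-refl

    -- If i = 1, the minimum is at least `w` and so is every entry. Otherwise dropping the head
    -- lowers the length and the index by one and does not raise the count.
    sorted-count : ∀ xs → AllPairs _≤_ xs → ∀ i w → 1 ≤ i → i ≤ length xs → w ≤ nth xs i →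
                   length xs < length (filter (w ≤?_) xs) + i
    sorted-count (x ∷ xs) (x≤ ∷ _) 1 w _ _ w≤x
      rewrite filter-all (w ≤?_) (w≤x ∷ All.map (≤-trans w≤x) x≤) = m<m+n _ (s≤s z≤n)
    sorted-count (x ∷ xs) (_ ∷ ps) (suc (suc i)) w _ (s≤s i≤) w≤ =
      ≤-trans (s≤s (sorted-count xs ps (suc i) w (s≤s z≤n) i≤ w≤))
        (≤-trans (s≤s (+-monoˡ-≤ (suc i) (length-filter-∷ w x xs))) (≤-reflexive (sym (+-suc _ (suc i)))))

    filter-tabulate : ∀ {m} {P : ℕ → Set} (P? : Decidable P) (g : Fin m → ℕ) →
                      length (filter P? (tabulate g)) ≡ ♯ (λ x → does (P? (g x)))
    filter-tabulate {zero}  P? g = refl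
    filter-tabulate {suc m} P? g with does (P? (g zero))
    ... | true  = cong suc (filter-tabulate P? (g ∘ suc))
    ... | false = filter-tabulate P? (g ∘ suc)

  sequence : ∀ {n} → (Fin n → ℕ) → ℕ → ℕ
  sequence {n} g = nth (sortℕ (map g (allFin n)))

  sequence-count : ∀ {n} (g : Fin n → ℕ) i w → 1 ≤ i → i ≤ n → w ≤ sequence g i → n < ♯ (λ x → ⌊ w ≤? g x ⌋) + i
  sequence-count {n} g i w 1≤i i≤n w≤ = subst₂ (λ l c → l < c + i) len count
    (sorted-count (sortℕ xs) (Linked⇒AllPairs ≤-trans (sort-↗ ≤-decTotalOrder xs)) i w 1≤i (subst (i ≤_) (sym len) i≤n) w≤)
    where
    xs = map g (allFin n)
    perm = sort-↭ ≤-decTotalOrder xs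
    len : length (sortℕ xs) ≡ n
    len = trans (↭-length perm) (trans (length-map g (allFin n)) (length-tabulate {n = n} (λ x → x)))
    count : length (filter (w ≤?_) (sortℕ xs)) ≡ ♯ (λ x → ⌊ w ≤? g x ⌋)
    count = trans (↭-length (filter-↭ (w ≤?_) perm))
      (trans (cong (λ l → length (filter (w ≤?_) l)) (map-tabulate (λ x → x) g)) 
        (trans (filter-tabulate (w ≤?_) g) (♯-cong (λ x → sym (isYes≗does (w ≤? g x))))))

  -- The hypothesis on the degree sequences with η = 1/a and without denominators.
  SequenceCond : ∀ {n} → ℕ → (Fin n → ℕ) → (Fin n → ℕ) → Set
  SequenceCond {n} a out inn = ∀ i → 1 ≤ i → 2 * i < n →
      (0 + i) * a + n ≤ sequence out i * a
    ⊎ Σ ℕ λ j → 1 ≤ j × j ≤ n × (j + i) * a + n ≤ n * a × n ≤ sequence inn j + i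

  private
    shift : ∀ a e i n d .{{_ : NonZero a}} → 8 * e * a ≤ n → i * a + n ≤ d * a → i + 8 * e ≤ d
    shift a e i n d h₁ h₂ = *-cancelʳ-≤ _ _ a
      (≤-trans (≤-reflexive (*-distribʳ-+ a i (8 * e))) (≤-trans (+-monoʳ-≤ (i * a) h₁) h₂))

    remaining : ∀ j i e n c → j + i + 8 * e ≤ n → n < c + j → i + 8 * e ≤ c
    remaining j i e n c p q = ≤-by 1 (+-mono-≤ p q) (eq j i e n c)
      where
      eq : ∀ j i e n c → i + 8 * e + (n + (c + j)) + 1 ≡ c + (j + i + 8 * e + (1 + n))
      eq = solve-∀

  -- As 8e ≤ n / a, the slack in the sequences covers 8e. In the second alternative more than n - j
  -- vertices have in-degree at least n - i, and n - j is at least i + 8e.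
  half : ∀ {n} a e (R : Rel n) out inn .{{_ : NonZero a}} → 8 * e * a ≤ n →
         (∀ x → out x ≡ ♯ (R x)) → (∀ y → inn y ≡ ♯ ((R ᵀ) y)) → SequenceCond a out inn → Half e R
  half {n} a e R out inn 8ea≤n out≡ inn≡ cond i 1≤i 2i<n with cond i 1≤i 2i<n
  ... | inj₁ h = inj₁ (subst (λ c → n < c + i) (♯-cong (λ x → cong (λ d → ⌊ i + 8 * e ≤? d ⌋) (out≡ x)))
          (sequence-count out i (i + 8 * e) 1≤i (≤-trans (m≤m+n i _) (<⇒≤ 2i<n)) (shift a e i n _ 8ea≤n h)))
  ... | inj₂ (j , 1≤j , j≤n , h , n≤) = inj₂ (≤-trans
          (remaining j i e n _ (shift a e (j + i) n n 8ea≤n h)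
            (sequence-count inn j (n ∸ i) 1≤j j≤n (m≤n+o⇒m∸n≤o n i (subst (n ≤_) (+-comm _ i) n≤))))
          (♯-mono (λ y → ⌊ n ∸ i ≤? inn y ⌋) (λ y → ⌊ n ≤? ♯ ((R ᵀ) y) + i ⌋)
            (λ y p → true-⌊⌋ (_ ≤? _) (subst (λ d → n ≤ d + i) (inn≡ y)
              (subst (n ≤_) (+-comm i _) (≤-trans (m≤n+m∸n n i) (+-monoʳ-≤ i (⌊⌋-true (_ ≤? _) p))))))))

  private
    missing-one : ∀ n i c → n ≤ i + 1 → i + c ≡ n → c ≤ 1
    missing-one _ i c p refl = +-cancelˡ-≤ i c 1 p

  -- A loopless vertex of in-degree at least n - 1 receives edges from all other vertices.
  min-degree : ∀ {n} e (R : Rel n) → (∀ x → R x x ≡ false) → 2 < n → Half e R → ∀ x → 8 * e ≤ ♯ (R x)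
  min-degree {n} e R loopless 2<n h x with h 1 ≤-refl 2<n
  ... | inj₁ all = ≤-trans (n≤1+n _) (⌊⌋-true (_ ≤? _) (♯-n⇒all _ (s≤s⁻¹ (subst (n <_) (+-comm _ 1) all)) x))
  ... | inj₂ many = s≤s⁻¹ (≤-trans many (≤-trans
          (sum-mono _ _ (λ y → pt y)) (≤-trans (≤-reflexive (∑-distrib-+ (λ y → ⟦ ⌊ y Fin.≟ x ⌋ ⟧) (λ y → ⟦ R x y ⟧)))
          (+-monoˡ-≤ _ (single x)))))
    where
    single : ∀ (x : Fin n) → ♯ (λ y → ⌊ y Fin.≟ x ⌋) ≤ 1
    single x = ♯-subsingleton (λ y → ⌊ y Fin.≟ x ⌋)
      (λ y z p q → trans (⌊⌋-true (y Fin.≟ x) p) (sym (⌊⌋-true (z Fin.≟ x) q)))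
    full : ∀ y → n ≤ ♯ ((R ᵀ) y) + 1 → y ≢ x → R x y ≡ true
    full y n≤ y≢x with R x y in eq
    ... | true  = refl
    ... | false = ⊥-elim (<⇒≱ (≤-trans (s≤s (♯-member (λ u → ⌊ u Fin.≟ y ⌋) y (true-⌊⌋ (y Fin.≟ y) refl)))
            (♯-strict {A = λ u → ⌊ u Fin.≟ y ⌋} {∁ ((R ᵀ) y)} at-y x (not-x (x Fin.≟ y)) (cong not eq)))
            (missing-one n (♯ ((R ᵀ) y)) _ n≤ (♯-∁ ((R ᵀ) y))))
      where
      at-y : ∀ u → ⌊ u Fin.≟ y ⌋ ≡ true → not (R u y) ≡ true
      at-y u p with ⌊⌋-true (u Fin.≟ y) p
      ... | refl = cong not (loopless u)
      not-x : ∀ (d : Dec (x ≡ y)) → ⌊ d ⌋ ≡ false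
      not-x (yes e) = ⊥-elim (y≢x (sym e))
      not-x (no _)  = refl
    pt : ∀ y → ⟦ ⌊ n ≤? ♯ ((R ᵀ) y) + 1 ⌋ ⟧ ≤ ⟦ ⌊ y Fin.≟ x ⌋ ⟧ + ⟦ R x y ⟧
    pt y with n ≤? ♯ ((R ᵀ) y) + 1 | y Fin.≟ x
    ... | no _   | _     = z≤n
    ... | yes _  | yes _ = s≤s z≤n
    ... | yes n≤ | no p  = ≤-reflexive (sym (cong ⟦_⟧ (full y n≤ p)))

  degree-cond : ∀ {n} a e (G : Digraph n) .{{_ : NonZero a}} → 2 < n → 8 * e * a ≤ n →
                SequenceCond a (outdeg G) (indeg G) → SequenceCond a (indeg G) (outdeg G) →
                DegreeCond e (Digraph.E G)
  degree-cond a e G 2<n 8ea≤n i ii = record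
    { half-out = out ; half-in = inn
    ; min-out = min-degree e E loopless 2<n out ; min-in = min-degree e (E ᵀ) loopless 2<n inn }
    where
    open Digraph G
    out : Half e E
    out = half a e E (outdeg G) (indeg G) 8ea≤n (λ x → length-elements (E x)) (λ y → length-elements ((E ᵀ) y)) i
    inn : Half e (E ᵀ)
    inn = half a e (E ᵀ) (indeg G) (outdeg G) 8ea≤n (λ y → length-elements ((E ᵀ) y)) (λ x → length-elements (E x)) ii

-- From rational inequalities to natural numbers.

module Rationals where

  import Data.Integer as ℤ
  import Data.Integer.Properties as ℤₚ
  open import Data.Nat using (ℕ; suc; _+_; _*_; _≤_)
  open import Data.Nat.Properties
  open import Data.Nat.Tactic.RingSolver using (solve-∀)
  open import Data.Rational as ℚ using (mkℚ; toℚᵘ; Positive; ↧ₙ_)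
  import Data.Rational.Properties as ℚₚ
  open import Data.Rational.Unnormalised as ℚᵘ using (mkℚᵘ)
  import Data.Rational.Unnormalised.Properties as ℚᵘₚ
  open import Data.Product using (Σ; _×_; _,_)
  open import Data.Sum using (_⊎_; inj₁; inj₂)
  open import Relation.Binary.PropositionalEquality
  open import Defs using (ℚ[_])

  private
    -- The shape which cross-multiplication of unnormalised fractions produces; the factors 1 are
    -- denominators of integers.
    numerators : ∀ b c b′ s j i n d →
      (ℤ.+ j ℤ.* ℤ.+ b ℤ.+ (ℤ.+ i ℤ.* ℤ.+ c ℤ.+ (ℤ.+ s ℤ.* ℤ.+ n) ℤ.* ℤ.+ 1) ℤ.* ℤ.+ 1) ℤ.* ℤ.+ 1 ℤ.≤ ℤ.+ d ℤ.* ℤ.+ b′ →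
      j * b + (i * c + s * n) ≤ d * b′
    numerators b c b′ s j i n d h
      rewrite ℤₚ.*-identityʳ (ℤ.+ j ℤ.* ℤ.+ b ℤ.+ (ℤ.+ i ℤ.* ℤ.+ c ℤ.+ (ℤ.+ s ℤ.* ℤ.+ n) ℤ.* ℤ.+ 1) ℤ.* ℤ.+ 1)
            | ℤₚ.*-identityʳ (ℤ.+ i ℤ.* ℤ.+ c ℤ.+ (ℤ.+ s ℤ.* ℤ.+ n) ℤ.* ℤ.+ 1)
            | ℤₚ.*-identityʳ (ℤ.+ s ℤ.* ℤ.+ n)
            | sym (ℤₚ.pos-* j b) | sym (ℤₚ.pos-* i c) | sym (ℤₚ.pos-* s n) | sym (ℤₚ.pos-* d b′) = ℤₚ.drop‿+≤+ h

    numerators′ : ∀ j i d → ℤ.+ j ℤ.* ℤ.+ 1 ℤ.≤ (ℤ.+ d ℤ.* ℤ.+ 1 ℤ.+ ℤ.+ i ℤ.* ℤ.+ 1) ℤ.* ℤ.+ 1 → j ≤ d + i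
    numerators′ j i d h
      rewrite ℤₚ.*-identityʳ (ℤ.+ j) | ℤₚ.*-identityʳ (ℤ.+ d) | ℤₚ.*-identityʳ (ℤ.+ i)
            | ℤₚ.*-identityʳ (ℤ.+ d ℤ.+ ℤ.+ i) = ℤₚ.drop‿+≤+ h

    toℚᵘ-ℚ[] : ∀ m → toℚᵘ ℚ[ m ] ℚᵘ.≃ mkℚᵘ (ℤ.+ m) 0
    toℚᵘ-ℚ[] m = ℚₚ.toℚᵘ-fromℚᵘ (mkℚᵘ (ℤ.+ m) 0)

    sub-+ : ∀ q r → q ℚ.- r ℚ.+ r ≡ q
    sub-+ q r = trans (ℚₚ.+-assoc q (ℚ.- r) r) (trans (cong (q ℚ.+_) (ℚₚ.+-inverseˡ r)) (ℚₚ.+-identityʳ q))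

  ≤-sub⇒+-≤ : ∀ p q r → p ℚ.≤ q ℚ.- r → p ℚ.+ r ℚ.≤ q
  ≤-sub⇒+-≤ p q r h = subst (p ℚ.+ r ℚ.≤_) (sub-+ q r) (ℚₚ.+-monoˡ-≤ r h)

  sub-≤⇒≤-+ : ∀ p q r → p ℚ.- r ℚ.≤ q → p ℚ.≤ q ℚ.+ r
  sub-≤⇒≤-+ p q r h = subst (ℚ._≤ q ℚ.+ r) (sub-+ p r) (ℚₚ.+-monoˡ-≤ r h)

  -- A positive fraction is at least the reciprocal of its denominator: the numerator `suc p` is
  -- rounded down to 1 after multiplying out.
  clear-denominator : ∀ η → Positive η → ∀ j i n d → ℚ[ j ] ℚ.+ (ℚ[ i ] ℚ.+ η ℚ.* ℚ[ n ]) ℚ.≤ ℚ[ d ] →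
                      (j + i) * ↧ₙ η + n ≤ d * ↧ₙ η
  clear-denominator η@(mkℚ (ℤ.+ suc p) a-1 _) _ j i n d h = subst₂ _≤_ (eq j i a n) (eq′ d a)
      (≤-trans (+-monoʳ-≤ (j * (1 * (a * 1))) (+-monoʳ-≤ (i * (a * 1)) (m≤m+n n (p * n))))
               (numerators (1 * (a * 1)) (a * 1) (1 * (1 * (a * 1))) (suc p) j i n d (ℚᵘₚ.drop-*≤* unnormalised)))
    where
    a = suc a-1
    eq : ∀ j i a n → j * (1 * (a * 1)) + (i * (a * 1) + n) ≡ (j + i) * a + n
    eq = solve-∀
    eq′ : ∀ d a → d * (1 * (1 * (a * 1))) ≡ d * a
    eq′ = solve-∀
    expand : toℚᵘ (ℚ[ j ] ℚ.+ (ℚ[ i ] ℚ.+ η ℚ.* ℚ[ n ])) ℚᵘ.≃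
             mkℚᵘ (ℤ.+ j) 0 ℚᵘ.+ (mkℚᵘ (ℤ.+ i) 0 ℚᵘ.+ toℚᵘ η ℚᵘ.* mkℚᵘ (ℤ.+ n) 0)
    expand = ℚᵘₚ.≃-trans (ℚₚ.toℚᵘ-homo-+ ℚ[ j ] _) (ℚᵘₚ.+-cong (toℚᵘ-ℚ[] j)
      (ℚᵘₚ.≃-trans (ℚₚ.toℚᵘ-homo-+ ℚ[ i ] _) (ℚᵘₚ.+-cong (toℚᵘ-ℚ[] i)
        (ℚᵘₚ.≃-trans (ℚₚ.toℚᵘ-homo-* η ℚ[ n ]) (ℚᵘₚ.*-cong (ℚᵘₚ.≃-refl {toℚᵘ η}) (toℚᵘ-ℚ[] n))))))
    unnormalised : mkℚᵘ (ℤ.+ j) 0 ℚᵘ.+ (mkℚᵘ (ℤ.+ i) 0 ℚᵘ.+ toℚᵘ η ℚᵘ.* mkℚᵘ (ℤ.+ n) 0) ℚᵘ.≤ mkℚᵘ (ℤ.+ d) 0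
    unnormalised = ℚᵘₚ.≤-respˡ-≃ expand (ℚᵘₚ.≤-respʳ-≃ (toℚᵘ-ℚ[] d) (ℚₚ.toℚᵘ-mono-≤ h))

  integral : ∀ j i d → ℚ[ j ] ℚ.≤ ℚ[ d ] ℚ.+ ℚ[ i ] → j ≤ d + i
  integral j i d h = numerators′ j i d (ℚᵘₚ.drop-*≤* unnormalised)
    where
    unnormalised : mkℚᵘ (ℤ.+ j) 0 ℚᵘ.≤ mkℚᵘ (ℤ.+ d) 0 ℚᵘ.+ mkℚᵘ (ℤ.+ i) 0
    unnormalised = ℚᵘₚ.≤-respˡ-≃ (toℚᵘ-ℚ[] j) (ℚᵘₚ.≤-respʳ-≃
      (ℚᵘₚ.≃-trans (ℚₚ.toℚᵘ-homo-+ ℚ[ d ] ℚ[ i ]) (ℚᵘₚ.+-cong (toℚᵘ-ℚ[] d) (toℚᵘ-ℚ[] i))) (ℚₚ.toℚᵘ-mono-≤ h))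

  discretise : ∀ η → Positive η → ∀ n i (O I : ℕ → ℕ) →
      ℚ[ i ] ℚ.+ η ℚ.* ℚ[ n ] ℚ.≤ ℚ[ O i ]
    ⊎ (Σ ℕ λ j → 1 ≤ j × j ≤ n × ℚ[ j ] ℚ.≤ ℚ[ n ] ℚ.- ℚ[ i ] ℚ.- η ℚ.* ℚ[ n ] × ℚ[ n ] ℚ.- ℚ[ i ] ℚ.≤ ℚ[ I j ]) →
      (0 + i) * ↧ₙ η + n ≤ O i * ↧ₙ η
    ⊎ (Σ ℕ λ j → 1 ≤ j × j ≤ n × (j + i) * ↧ₙ η + n ≤ n * ↧ₙ η × n ≤ I j + i)
  discretise η η>0 n i O I (inj₁ h) = inj₁ (clear-denominator η η>0 0 i n (O i)
    (subst (ℚ._≤ ℚ[ O i ]) (sym (ℚₚ.+-identityˡ _)) h))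
  discretise η η>0 n i O I (inj₂ (j , 1≤j , j≤n , h , h′)) = inj₂ (j , 1≤j , j≤n ,
    clear-denominator η η>0 j i n n (subst (ℚ._≤ ℚ[ n ]) swap
      (≤-sub⇒+-≤ (ℚ[ j ] ℚ.+ ηn) ℚ[ n ] ℚ[ i ] (≤-sub⇒+-≤ ℚ[ j ] (ℚ[ n ] ℚ.- ℚ[ i ]) ηn h))) ,
    integral n i (I j) (sub-≤⇒≤-+ ℚ[ n ] ℚ[ I j ] ℚ[ i ] h′))
    where
    ηn = η ℚ.* ℚ[ n ]
    swap : ℚ[ j ] ℚ.+ ηn ℚ.+ ℚ[ i ] ≡ ℚ[ j ] ℚ.+ (ℚ[ i ] ℚ.+ ηn)
    swap = trans (ℚₚ.+-assoc ℚ[ j ] ηn ℚ[ i ]) (cong (ℚ[ j ] ℚ.+_) (ℚₚ.+-comm ηn ℚ[ i ]))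

-- Choice of the constants.

module Conclusion where

  open import Data.Nat
  open import Data.Nat.DivMod using (m≡m%n+[m/n]*n; m%n<n; m/n*n≤m; m≥n⇒m/n>0)
  open import Data.Nat.Properties
  open import Data.Nat.Tactic.RingSolver using (solve-∀)
  open import Relation.Binary.PropositionalEquality
  open Chains
  open Descent
  open Sequences
  open import Defs using (Digraph; HamiltonCycle; outdeg; indeg)

  -- The summand 8a makes the slack e positive; 3 makes 1 an admissible index, 2 < n.
  threshold : ℕ → ℕ
  threshold a = Constants.n₀ (16 * a) + (8 * a + 3)

  hamilton-cycle : ∀ a .{{_ : NonZero a}} n → threshold a ≤ n → (G : Digraph n) →
                   SequenceCond a (outdeg G) (indeg G) → SequenceCond a (indeg G) (outdeg G) → HamiltonCycle G
  hamilton-cycle a@(suc a-1) n large G i ii =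
    hamiltonian (16 * a) e G (degree-cond a e G 2<n 8ea≤n i ii) (s≤s z≤n) 1≤e 8e≤n n≤Ke
      (≤-trans (m≤m+n _ _) large)
    where
    -- The largest e with 8ea ≤ n. As e ≥ 1, it satisfies n < 8a(e + 1) ≤ 16ae, which is why `K` is
    -- 16a.
    e = n / (8 * a)
    large′ : 8 * a + 3 ≤ n
    large′ = ≤-trans (m≤n+m (8 * a + 3) (Constants.n₀ (16 * a))) large
    2<n : 2 < n
    2<n = ≤-trans (m≤n+m 3 (8 * a)) large′
    8a≤n : 8 * a ≤ n
    8a≤n = ≤-trans (m≤m+n (8 * a) 3) large′
    1≤e : 1 ≤ e
    1≤e = m≥n⇒m/n>0 8a≤n
    8ea≤n : 8 * e * a ≤ n
    8ea≤n = ≤-trans (≤-reflexive (eq e a)) (m/n*n≤m n (8 * a))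
      where
      eq : ∀ e a → 8 * e * a ≡ e * (8 * a)
      eq = solve-∀
    8e≤n : 8 * e ≤ n
    8e≤n = ≤-trans (m≤m*n (8 * e) a) 8ea≤n
    n≤Ke : n ≤ 16 * a * e
    n≤Ke = begin
      n                              ≡⟨ m≡m%n+[m/n]*n n (8 * a) ⟩
      n % (8 * a) + e * (8 * a)      ≤⟨ +-monoˡ-≤ _ (<⇒≤ (m%n<n n (8 * a))) ⟩
      8 * a + e * (8 * a)            ≤⟨ +-monoˡ-≤ _ (m≤n*m (8 * a) e {{>-nonZero 1≤e}}) ⟩
      e * (8 * a) + e * (8 * a)      ≡⟨ eq e a ⟩
      16 * a * e                     ∎
      where
      open ≤-Reasoning
      eq : ∀ e a → e * (8 * a) + e * (8 * a) ≡ 16 * a * e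
      eq = solve-∀

open import Defs
open import Data.Nat using (ℕ; _≤_; _<_) renaming (_*_ to _*ℕ_)
open import Data.Product using (Σ; ∃; _×_; _,_; proj₁; proj₂)
open import Data.Sum using (_⊎_)
open import Data.Rational using (ℚ; Positive; _+_; _-_; _*_; ↧ₙ_) renaming (_≤_ to _≤ℚ_)

theorem2 : (η : ℚ) → Positive η →
    Σ ℕ λ n₀ → ∀ (n : ℕ) → n₀ ≤ n → (G : Digraph n) →
    (∀ (i : ℕ) → 1 ≤ i → 2 *ℕ i < n →
      (ℚ[ i ] + η * ℚ[ n ] ≤ℚ ℚ[ d⁺ G i ]
        ⊎ Σ ℕ λ j → 1 ≤ j × j ≤ n × ℚ[ j ] ≤ℚ ℚ[ n ] - ℚ[ i ] - η * ℚ[ n ]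
                    × ℚ[ n ] - ℚ[ i ] ≤ℚ ℚ[ d⁻ G j ])
      × (ℚ[ i ] + η * ℚ[ n ] ≤ℚ ℚ[ d⁻ G i ]
        ⊎ Σ ℕ λ j → 1 ≤ j × j ≤ n × ℚ[ j ] ≤ℚ ℚ[ n ] - ℚ[ i ] - η * ℚ[ n ]
                    × ℚ[ n ] - ℚ[ i ] ≤ℚ ℚ[ d⁺ G j ])) →
    HamiltonCycle G
theorem2 η η>0 = Conclusion.threshold (↧ₙ η) , λ n large G h →
  Conclusion.hamilton-cycle (↧ₙ η) n large G
    (λ i 1≤i 2i<n → Rationals.discretise η η>0 n i (d⁺ G) (d⁻ G) (proj₁ (h i 1≤i 2i<n)))
    (λ i 1≤i 2i<n → Rationals.discretise η η>0 n i (d⁻ G) (d⁺ G) (proj₂ (h i 1≤i 2i<n)))
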